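{- There is a class of subcubic trees (trees of maximum degree at most $3$) that has bounded radius-$r$ blind cop-width for every positive integer $r$ and unbounded pathwidth, and consequently has bounded blind flip-width and unbounded linear clique-width.
   Context: All graphs are finite, simple and undirected. For a graph $G$ and a positive integer $r$, a blind strategy of radius $r$ is a sequence $C_1,\dots,C_m\subseteq V(G)$ using $\max_i|C_i|$ cops, with $A_1=V(G)\setminus C_1$ and $A_{i+1}$ the set of $u\in V(G)\setminus C_{i+1}$ reachable from some vertex of $A_i$ by a path of length at most $r$ (length $0$ allowed) in $G\setminus(C_i\cap C_{i+1})$; it is winning if $A_m=\emptyset$. $\mathrm{bcw}_r(G)$ is the minimum number of cops of a winning strategy. A class $\mathscr C$ has bounded radius-$r$ blind cop-width if $\sup_{G\in\mathscr C}\mathrm{bcw}_r(G)<\infty$. A $k$-flip of $G$ is a pair $(\mathcal P,F)$ where $\mathcal P$ is a partition of $V(G)$ into at most $k$ parts and $F$ is a graph (loops allowed) on vertex set $\mathcal P$; flipping $G$ by $(\mathcal P,F)$ yields the graph on $V(G)$ in which distinct $u,v$ with parts $P\ni u$, $Q\ni v$ are adjacent iff exactly one of $\{u,v\}\in E(G)$ and $\{P,Q\}\in E(F)$ holds. In the blind radius-$r$ flipper game, the flipper fixes in advance a sequence of $k$-flips $f_1,\dots,f_m$; let $G_0=G$ and $G_i$ be $G$ flipped by $f_i$. Let $R_0$ be the set of non-isolated vertices of $G_0$ and, for $i\ge1$, $R_i$ the set of vertices that are non-isolated in $G_i$ and reachable by a path of length at most $r$ in $G_{i-1}$ from some vertex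 of $R_{i-1}$. The flipper wins if $R_m=\emptyset$. The radius-$r$ blind flip-width $\mathrm{bfw}_r(G)$ is the minimum $k$ for which the flipper has a winning sequence of $k$-flips. A class $\mathscr C$ has bounded blind flip-width if there is $f:\mathbb N\to\mathbb N$ with $\mathrm{bfw}_r(G)\le f(r)$ for all $r\in\mathbb N$ and $G\in\mathscr C$. Linear clique-width is the standard graph parameter (the linear version of clique-width). -}

module Defs where

open import Data.Nat using (ℕ; zero; suc; _+_; _≤_; _<_)
open import Data.Bool using (Bool; true; false; _xor_; _∨_; _∧_; if_then_else_)
open import Data.Fin using (Fin; toℕ; fromℕ) renaming (zero to fzero; suc to fsuc)
import Data.Fin as Fin
open import Data.Fin.Subset using (Subset; _∈_; _∉_; _∩_; ∣_∣) renaming (⊥ to ∅)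
open import Data.Vec using (tabulate; _[_]=_)
open import Data.List using (List; []; _∷_)
open import Data.List.Relation.Unary.All using (All)
open import Data.Maybe using (Maybe; just; nothing)
open import Data.Product using (Σ; ∃; _×_; _,_)
open import Data.Empty using (⊥)
open import Relation.Nullary using (¬_; yes; no)
open import Relation.Nullary.Decidable using (⌊_⌋)
open import Relation.Binary.PropositionalEquality using (_≡_; _≢_)
open import Function.Definitions using (Injective)

record Graph (n : ℕ) : Set where
  field
    adj    : Fin n → Fin n → Bool
    sym    : ∀ u v → adj u v ≡ adj v u
    irrefl : ∀ u → adj u u ≡ false
open Graph public

-- Walks of length at most k from u to w using only edges of E,
-- and only vertices outside the deleted set X (i.e. walks in E \ X).
-- (Reachability by a walk of length ≤ k is the same as by a path of length ≤ k.)
data Reach {n : ℕ} (E : Fin n → Fin n → Bool) (X : Subset n)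
     : ℕ → Fin n → Fin n → Set where
  stay : ∀ {k u} → u ∉ X → Reach E X k u u
  move : ∀ {k u v w} → u ∉ X → E u v ≡ true → Reach E X k v w
       → Reach E X (suc k) u w

degree : ∀ {n} → Graph n → Fin n → ℕ
degree G v = ∣ tabulate (adj G v) ∣

MaxDegree≤ : ∀ {n} → ℕ → Graph n → Set
MaxDegree≤ d G = ∀ v → degree G v ≤ d

Connected : ∀ {n} → Graph n → Set
Connected {n} G = (0 < n) × (∀ u v → ∃ λ k → Reach (adj G) ∅ k u v)

HasCycle : ∀ {n} → Graph n → Set
HasCycle {n} G =
  ∃ λ k → Σ (Fin (3 + k) → Fin n) λ c →
    Injective _≡_ _≡_ c ×
    (∀ i j → toℕ j ≡ suc (toℕ i) → adj G (c i) (c j) ≡ true) ×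
    (adj G (c (fromℕ (2 + k))) (c fzero) ≡ true)

IsTree : ∀ {n} → Graph n → Set
IsTree G = Connected G × ¬ HasCycle G

IsSubcubicTree : ∀ {n} → Graph n → Set
IsSubcubicTree G = IsTree G × MaxDegree≤ 3 G

Class : Set₁
Class = ∀ {n} → Graph n → Set

-- escape set A_m, given the previous cop set and A_i, after the remaining cop sets
escape : ∀ {n} → Graph n → ℕ → Subset n → (Fin n → Set) → List (Subset n) → Fin n → Set
escape G r Cprev A [] = A
escape G r Cprev A (C ∷ Cs) =
  escape G r C (λ u → u ∉ C × ∃ λ a → A a × Reach (adj G) (Cprev ∩ C) r a u) Cs

BlindCopWins : ∀ {n} → ℕ → ℕ → Graph n → Set
BlindCopWins {n} r k G =
  Σ (Subset n) λ C₁ → Σ (List (Subset n)) λ Cs →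
    All (λ C → ∣ C ∣ ≤ k) (C₁ ∷ Cs) ×
    (∀ u → ¬ escape G r C₁ (λ u → u ∉ C₁) Cs u)

bcw≤ : ∀ {n} → ℕ → Graph n → ℕ → Set
bcw≤ r G k = BlindCopWins r k G

BoundedBlindCopWidth : ℕ → Class → Set
BoundedBlindCopWidth r 𝒞 = ∃ λ k → ∀ {n} (G : Graph n) → 𝒞 G → bcw≤ r G k

-- a k-flip: partition into at most k parts (given by a part map) and a
-- graph with loops allowed on the parts
record Flip (n k : ℕ) : Set where
  field
    part  : Fin n → Fin k
    F     : Fin k → Fin k → Bool
    F-sym : ∀ P Q → F P Q ≡ F Q P
open Flip public

flipAdj : ∀ {n k} → Graph n → Flip n k → Fin n → Fin n → Bool
flipAdj G f u v with u Fin.≟ v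
... | yes _ = false
... | no  _ = adj G u v xor F f (part f u) (part f v)

NonIsolated : ∀ {n} → (Fin n → Fin n → Bool) → Fin n → Set
NonIsolated E u = ∃ λ v → E u v ≡ true

-- R_m, given the adjacency of G_{i-1} and R_{i-1}, after the remaining flips
remaining : ∀ {n k} → Graph n → ℕ → (Fin n → Fin n → Bool) → (Fin n → Set)
          → List (Flip n k) → Fin n → Set
remaining G r Eprev R [] = R
remaining G r Eprev R (f ∷ fs) =
  remaining G r (flipAdj G f)
    (λ u → NonIsolated (flipAdj G f) u × ∃ λ a → R a × Reach Eprev ∅ r a u) fs

FlipperWins : ∀ {n} → ℕ → ℕ → Graph n → Set
FlipperWins {n} r k G =
  Σ (List (Flip n k)) λ fs →
    ∀ u → ¬ remaining G r (adj G) (NonIsolated (adj G)) fs u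

bfw≤ : ∀ {n} → ℕ → Graph n → ℕ → Set
bfw≤ r G k = FlipperWins r k G

BoundedBlindFlipWidth : Class → Set
BoundedBlindFlipWidth 𝒞 = Σ (ℕ → ℕ) λ f → ∀ r {n} (G : Graph n) → 𝒞 G → bfw≤ r G (f r)

record PathDecomposition {n : ℕ} (G : Graph n) : Set where
  field
    len   : ℕ
    bag   : Fin len → Subset n
    cover : ∀ v → ∃ λ i → v ∈ bag i
    edges : ∀ u v → adj G u v ≡ true → ∃ λ i → u ∈ bag i × v ∈ bag i
    interpolate : ∀ v i j l → toℕ i ≤ toℕ j → toℕ j ≤ toℕ l →
                  v ∈ bag i → v ∈ bag l → v ∈ bag j
open PathDecomposition public

pw≤ : ∀ {n} → Graph n → ℕ → Set
pw≤ G k = Σ (PathDecomposition G) λ D → ∀ i → ∣ bag D i ∣ ≤ suc k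

UnboundedPathwidth : Class → Set
UnboundedPathwidth 𝒞 = ∀ k → ∃ λ n → Σ (Graph n) λ G → 𝒞 G × ¬ pw≤ G k

data LOp (n k : ℕ) : Set where
  create  : Fin n → Fin k → LOp n k
  join    : Fin k → Fin k → LOp n k
  relabel : Fin k → Fin k → LOp n k

record LState (n k : ℕ) : Set where
  constructor ⟨_,_⟩
  field
    label : Fin n → Maybe (Fin k)      -- nothing = not yet created
    edge  : Fin n → Fin n → Bool
open LState public

hasLabel : ∀ {n k} → LState n k → Fin k → Fin n → Bool
hasLabel s i v with label s v
... | nothing = false
... | just j  = ⌊ i Fin.≟ j ⌋

step : ∀ {n k} → LOp n k → LState n k → Maybe (LState n k)
step (create v i) s with label s v
... | just _  = nothing
... | nothing = just ⟨ (λ u → if ⌊ u Fin.≟ v ⌋ then just i else label s u) , edge s ⟩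
step (join i j) s with i Fin.≟ j
... | yes _ = nothing
... | no  _ = just ⟨ label s , (λ u v → edge s u v ∨ (hasLabel s i u ∧ hasLabel s j v)
                                                 ∨ (hasLabel s j u ∧ hasLabel s i v)) ⟩
step (relabel i j) s =
  just ⟨ (λ u → if hasLabel s i u then just j else label s u) , edge s ⟩

run : ∀ {n k} → List (LOp n k) → LState n k → Maybe (LState n k)
run [] s = just s
run (o ∷ os) s with step o s
... | nothing = nothing
... | just s' = run os s'

emptyState : ∀ {n k} → LState n k
emptyState = ⟨ (λ _ → nothing) , (λ _ _ → false) ⟩

LinearExpression : ∀ {n} → ℕ → Graph n → Set
LinearExpression {n} k G =
  Σ (List (LOp n k)) λ ops → Σ (LState n k) λ s →
    run ops emptyState ≡ just s ×
    (∀ v → ∃ λ i → label s v ≡ just i) ×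
    (∀ u v → edge s u v ≡ adj G u v)

lcw≤ : ∀ {n} → Graph n → ℕ → Set
lcw≤ G k = LinearExpression k G

UnboundedLinearCliqueWidth : Class → Set
UnboundedLinearCliqueWidth 𝒞 = ∀ k → ∃ λ n → Σ (Graph n) λ G → 𝒞 G × ¬ lcw≤ G k

{-# OPTIONS --safe #-}

-- The class consists of binary trees built recursively: the root of the tree of height h + 1
-- has a copy of the tree of height h as one child, and at the other side a long path (the arm)
-- leading to a second copy.
--
-- Cops.  For fixed r, trees of height at most r are simply covered.  In a higher tree the cops
-- clear the lower copy, sweep the arm, abandon it and clear the upper copy.  Meanwhile the
-- contamination comes back at speed r, but the arm is so long that it does not reach the lower
-- copy, so a second sweep of the arm suffices, with one cop left at the root of the upper copy.
-- Hence the number of cops depends on r only.  Since degrees are bounded, a flip isolating a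
-- cop set takes boundedly many parts, and the flipper can imitate the cops.
--
-- Widths.  Given a linear layout of a tree, take three disjoint subtrees and, for each, the
-- moment at which it has most active vertices.  At the middle moment, one of the other two
-- subtrees has already begun and the last one is not yet finished, so the path joining them
-- contributes one more active vertex.  Thus the number of active vertices grows with the
-- height, while bounded pathwidth or (in bounded degree) linear clique-width bounds it.
module Submission where

open import Defs
open import Data.Nat using (ℕ; zero; suc; _+_; _*_; _≤_; _<_; z≤n; s≤s; s≤s⁻¹; _≤?_; _<?_; _≟_)
open import Data.Nat.Properties using (≤-refl; ≤-reflexive; ≤-trans; ≤-total; <-irrefl; <⇒≤; <-≤-trans; ≤-<-trans; ≤∧≢⇒<; ≮⇒≥; ≰⇒>; n≤1+n; m≤n⇒m≤1+n; m≤m+n; m≤n+m; +-mono-≤; +-monoˡ-≤; +-monoʳ-≤; *-mono-≤; *-monoˡ-≤; *-comm; +-comm; +-assoc; +-suc; +-identityʳ; suc-injective; m≤n⇒m<n∨m≡n)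
open import Data.Bool using (Bool; true; false; _xor_; _∨_; _∧_; if_then_else_)
open import Data.Bool.Properties using (∨-comm; xor-identityʳ)
open import Data.Fin using (Fin; toℕ; fromℕ; fromℕ<; inject₁; splitAt; _↑ˡ_; _↑ʳ_) renaming (zero to fzero; suc to fsuc)
open import Data.Fin.Properties using (toℕ-injective; toℕ-fromℕ; toℕ-fromℕ<; toℕ-inject₁; toℕ<n; splitAt-↑ˡ; splitAt-↑ʳ; join-splitAt)
open import Data.Fin.Subset using (Subset; inside; outside; _∈_; _∉_; _⊆_; _∩_; ∣_∣; _-_) renaming (⊥ to ∅)
open import Data.Fin.Subset.Properties using (_∈?_; ∉⊥; x∈p∩q⁺; x∈p∩q⁻; ∣⊥∣≡0; p⊆q⇒∣p∣≤∣q∣; x∈p∧x≢y⇒x∈p-y; x∈p⇒∣p-x∣<∣p∣)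
open import Data.Vec using (_∷_; []; tabulate; lookup; _[_]≔_; here; there)
open import Data.Vec.Properties using ([]≔-updates; []≔-minimal; lookup∘tabulate; []=⇒lookup; lookup⇒[]=)
open import Data.List using (List; []; _∷_; _++_; map; length; filter; concatMap)
open import Data.List.Properties using (length-map; length-++)
open import Data.List.Relation.Unary.All using (All; []; _∷_)
open import Data.List.Relation.Unary.Any using (here; there)
open import Data.List.Relation.Unary.AllPairs using ([]; _∷_)
open import Data.List.Relation.Unary.Unique.Propositional using (Unique)
open import Data.List.Membership.Propositional.Properties using (∈-map⁺; ∈-map⁻; ∈-++⁺ˡ; ∈-++⁺ʳ; ∈-++⁻; ∈-concatMap⁺)
open import Data.List.Membership.Propositional using (lose)
open import Data.Maybe using (Maybe; just; nothing; maybe′)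
open import Data.Maybe.Properties using (just-injective)
open import Data.Product using (Σ; ∃; _×_; _,_; proj₁; proj₂)
open import Data.Sum using (_⊎_; inj₁; inj₂; [_,_]′; swap)
open import Data.Empty using (⊥)
open import Function using (_∘_; id)
open import Relation.Nullary using (¬_; Dec; ¬?; yes; no; contradiction)
open import Relation.Nullary.Decidable using (⌊_⌋)
open import Relation.Binary.PropositionalEquality using (_≡_; _≢_; refl; cong; cong₂; subst; trans) renaming (sym to ≡-sym)
open import Relation.Binary.Construct.Closure.ReflexiveTransitive using (Star; ε; _◅_; _◅◅_; gmap; reverse)
import Data.Fin as Fin
import Data.List.Relation.Unary.All as All
import Data.List.Relation.Unary.All.Properties as All
import Data.List.Relation.Unary.Unique.Propositional.Properties as Unique
import Data.List.Membership.Propositional as List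
import Data.Sum as Sum

-- Subsets of vertices given by lists

fromList : ∀ {n} → List (Fin n) → Subset n
fromList []       = ∅
fromList (x ∷ xs) = fromList xs [ x ]≔ inside

∈-fromList : ∀ {n} {x : Fin n} {xs} → x List.∈ xs → x ∈ fromList xs
∈-fromList {xs = y ∷ xs} (here refl) = []≔-updates (fromList xs) y
∈-fromList {x = x} {xs = y ∷ xs} (there m) with x Fin.≟ y
... | yes refl = []≔-updates (fromList xs) y
... | no x≢y   = []≔-minimal (fromList xs) x y x≢y (∈-fromList m)

∣insert∣ : ∀ {n} (p : Subset n) x → ∣ p [ x ]≔ inside ∣ ≤ suc ∣ p ∣
∣insert∣ (outside ∷ p) fzero    = ≤-refl
∣insert∣ (inside  ∷ p) fzero    = n≤1+n _
∣insert∣ (outside ∷ p) (fsuc x) = ∣insert∣ p x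
∣insert∣ (inside  ∷ p) (fsuc x) = s≤s (∣insert∣ p x)

∣fromList∣ : ∀ {n} (xs : List (Fin n)) → ∣ fromList xs ∣ ≤ length xs
∣fromList∣ {n} []   = ≤-reflexive (∣⊥∣≡0 n)
∣fromList∣ (x ∷ xs) = ≤-trans (∣insert∣ (fromList xs) x) (s≤s (∣fromList∣ xs))

unique-length : ∀ {n} {p : Subset n} {xs} → Unique xs → All (_∈ p) xs → length xs ≤ ∣ p ∣
unique-length [] [] = z≤n
unique-length {p = p} {x ∷ xs} (x∉xs ∷ u) (x∈p ∷ xs∈p) =
  ≤-trans (s≤s (unique-length u (All.zipWith rest (x∉xs , xs∈p)))) (x∈p⇒∣p-x∣<∣p∣ x∈p)
  where
    rest : ∀ {y} → x ≢ y × y ∈ p → y ∈ p - x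
    rest (x≢y , y∈p) = x∈p∧x≢y⇒x∈p-y y∈p (x≢y ∘ ≡-sym)

∈-tabulate⁺ : ∀ {n} {f : Fin n → Bool} {x} → f x ≡ true → x ∈ tabulate f
∈-tabulate⁺ {f = f} {x} eq = lookup⇒[]= x (tabulate f) (trans (lookup∘tabulate f x) eq)

∈-tabulate⁻ : ∀ {n} {f : Fin n → Bool} {x} → x ∈ tabulate f → f x ≡ true
∈-tabulate⁻ {f = f} {x} m = trans (≡-sym (lookup∘tabulate f x)) ([]=⇒lookup m)

-- Rooted binary trees as graphs

data Tree : Set where
  nil  : Tree
  node : Tree → Tree → Tree

data Pos : Tree → Set where
  top   : ∀ {l r} → Pos (node l r)
  left  : ∀ {l r} → Pos l → Pos (node l r)
  right : ∀ {l r} → Pos r → Pos (node l r)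

left-injective : ∀ {l r} {p q : Pos l} → left {l} {r} p ≡ left q → p ≡ q
left-injective refl = refl

right-injective : ∀ {l r} {p q : Pos r} → right {l} {r} p ≡ right q → p ≡ q
right-injective refl = refl

data IsTop : ∀ {t} → Pos t → Set where
  top : ∀ {l r} → IsTop (top {l} {r})

isTop : ∀ {t} → Pos t → Bool
isTop top       = true
isTop (left _)  = false
isTop (right _) = false

infix 4 _◁_ _∼_

-- p ◁ q : p is the parent of q
data _◁_ : ∀ {t} → Pos t → Pos t → Set where
  topˡ  : ∀ {l r} {p : Pos l} → IsTop p → top {l} {r} ◁ left p
  topʳ  : ∀ {l r} {p : Pos r} → IsTop p → top {l} {r} ◁ right p
  left  : ∀ {l r} {p q : Pos l} → p ◁ q → left {l} {r} p ◁ left q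
  right : ∀ {l r} {p q : Pos r} → p ◁ q → right {l} {r} p ◁ right q

_∼_ : ∀ {t} → Pos t → Pos t → Set
p ∼ q = p ◁ q ⊎ q ◁ p

-- The Boolean form that `Graph` asks for. The arguments use `_∼_`, whose proofs can be matched on,
-- and translate by `adjP⇒∼` and `∼⇒adjP`.
adjP : ∀ {t} → Pos t → Pos t → Bool
adjP top       top       = false
adjP top       (left q)  = isTop q
adjP top       (right q) = isTop q
adjP (left p)  top       = isTop p
adjP (left p)  (left q)  = adjP p q
adjP (left p)  (right q) = false
adjP (right p) top       = isTop p
adjP (right p) (left q)  = false
adjP (right p) (right q) = adjP p q

adjP-sym : ∀ {t} (p q : Pos t) → adjP p q ≡ adjP q p
adjP-sym top       top       = refl
adjP-sym top       (left q)  = refl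
adjP-sym top       (right q) = refl
adjP-sym (left p)  top       = refl
adjP-sym (left p)  (left q)  = adjP-sym p q
adjP-sym (left p)  (right q) = refl
adjP-sym (right p) top       = refl
adjP-sym (right p) (left q)  = refl
adjP-sym (right p) (right q) = adjP-sym p q

adjP-irrefl : ∀ {t} (p : Pos t) → adjP p p ≡ false
adjP-irrefl top       = refl
adjP-irrefl (left p)  = adjP-irrefl p
adjP-irrefl (right p) = adjP-irrefl p

isTop⇒IsTop : ∀ {t} {p : Pos t} → isTop p ≡ true → IsTop p
isTop⇒IsTop {p = top} _ = top

IsTop⇒isTop : ∀ {t} {p : Pos t} → IsTop p → isTop p ≡ true
IsTop⇒isTop top = refl

adjP⇒∼ : ∀ {t} (p q : Pos t) → adjP p q ≡ true → p ∼ q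
adjP⇒∼ top       (left q)  e = inj₁ (topˡ (isTop⇒IsTop e))
adjP⇒∼ top       (right q) e = inj₁ (topʳ (isTop⇒IsTop e))
adjP⇒∼ (left p)  top       e = inj₂ (topˡ (isTop⇒IsTop e))
adjP⇒∼ (left p)  (left q)  e = Sum.map left left (adjP⇒∼ p q e)
adjP⇒∼ (right p) top       e = inj₂ (topʳ (isTop⇒IsTop e))
adjP⇒∼ (right p) (right q) e = Sum.map right right (adjP⇒∼ p q e)

◁⇒adjP : ∀ {t} {p q : Pos t} → p ◁ q → adjP p q ≡ true
◁⇒adjP (topˡ i)  = IsTop⇒isTop i
◁⇒adjP (topʳ i)  = IsTop⇒isTop i
◁⇒adjP (left e)  = ◁⇒adjP e
◁⇒adjP (right e) = ◁⇒adjP e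

∼⇒adjP : ∀ {t} {p q : Pos t} → p ∼ q → adjP p q ≡ true
∼⇒adjP (inj₁ e)                 = ◁⇒adjP e
∼⇒adjP {p = p} {q} (inj₂ e) = trans (adjP-sym p q) (◁⇒adjP e)

size : Tree → ℕ
size nil        = 0
size (node l r) = suc (size l + size r)

pos : ∀ t → Fin (size t) → Pos t
pos (node l r) fzero    = top
pos (node l r) (fsuc i) = [ left ∘ pos l , right ∘ pos r ]′ (splitAt (size l) i)

index : ∀ {t} → Pos t → Fin (size t)
index top                = fzero
index {node l r} (left p)  = fsuc (index p ↑ˡ size r)
index {node l r} (right p) = fsuc (size l ↑ʳ index p)

pos-index : ∀ {t} (p : Pos t) → pos t (index p) ≡ p
pos-index top = refl
pos-index {node l r} (left p)
  rewrite splitAt-↑ˡ (size l) (index p) (size r) = cong left (pos-index p)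
pos-index {node l r} (right p)
  rewrite splitAt-↑ʳ (size l) (size r) (index p) = cong right (pos-index p)

index-pos : ∀ t u → index (pos t u) ≡ u
index-pos (node l r) fzero = refl
index-pos (node l r) (fsuc i) with splitAt (size l) i | join-splitAt (size l) (size r) i
... | inj₁ j | refl = cong (λ k → fsuc (k ↑ˡ size r)) (index-pos l j)
... | inj₂ j | refl = cong (λ k → fsuc (size l ↑ʳ k)) (index-pos r j)

pos-injective : ∀ t {u v} → pos t u ≡ pos t v → u ≡ v
pos-injective t {u} {v} e = trans (≡-sym (index-pos t u)) (trans (cong index e) (index-pos t v))

index-injective : ∀ {t} {p q : Pos t} → index p ≡ index q → p ≡ q
index-injective {p = p} {q} e = trans (≡-sym (pos-index p)) (trans (cong (pos _) e) (pos-index q))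

treeGraph : ∀ t → Graph (size t)
treeGraph t = record
  { adj    = λ u v → adjP (pos t u) (pos t v)
  ; sym    = λ u v → adjP-sym (pos t u) (pos t v)
  ; irrefl = λ u → adjP-irrefl (pos t u)
  }

adj-index : ∀ {t} {p q : Pos t} → p ∼ q → adj (treeGraph t) (index p) (index q) ≡ true
adj-index {p = p} {q} e = trans (cong₂ adjP (pos-index p) (pos-index q)) (∼⇒adjP e)

adj⇒∼ : ∀ t {u v} → adj (treeGraph t) u v ≡ true → pos t u ∼ pos t v
adj⇒∼ t {u} {v} = adjP⇒∼ (pos t u) (pos t v)

-- Takes a position because `nil` has no root; by `rootOf-constant` every position gives the same
-- result.
rootOf : ∀ {t} → Pos t → Pos t
rootOf top       = top
rootOf (left _)  = top
rootOf (right _) = top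

rootOf-constant : ∀ {t} (p q : Pos t) → rootOf p ≡ rootOf q
rootOf-constant {node _ _} p q = trans (is-top p) (≡-sym (is-top q))
  where
    is-top : ∀ {l r} (p : Pos (node l r)) → rootOf p ≡ top
    is-top top       = refl
    is-top (left _)  = refl
    is-top (right _) = refl

rootOf-IsTop : ∀ {t} (p : Pos t) → IsTop (rootOf p)
rootOf-IsTop top       = top
rootOf-IsTop (left _)  = top
rootOf-IsTop (right _) = top

path-to-root : ∀ {t} (p : Pos t) → Star _∼_ p (rootOf p)
path-to-root top       = ε
path-to-root (left p)  =
  gmap left (Sum.map left left) (path-to-root p) ◅◅ (inj₂ (topˡ (rootOf-IsTop p)) ◅ ε)
path-to-root (right p) =
  gmap right (Sum.map right right) (path-to-root p) ◅◅ (inj₂ (topʳ (rootOf-IsTop p)) ◅ ε)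

treeGraph-connected : ∀ l r → Connected (treeGraph (node l r))
treeGraph-connected l r = s≤s z≤n , λ u v → reach u v (path u v)
  where
    t = node l r

    path : ∀ u v → Star _∼_ (pos t u) (pos t v)
    path u v = path-to-root (pos t u) ◅◅
      subst (λ p → Star _∼_ p (pos t v)) (rootOf-constant (pos t v) (pos t u))
        (reverse swap (path-to-root (pos t v)))

    walk : ∀ {p q} → Star _∼_ p q → ∃ λ k → Reach (adj (treeGraph t)) ∅ k (index p) (index q)
    walk ε       = 0 , stay ∉⊥
    walk (e ◅ s) with walk s
    ... | k , w = suc k , move ∉⊥ (adj-index e) w

    reach : ∀ u v → Star _∼_ (pos t u) (pos t v) → ∃ λ k → Reach (adj (treeGraph t)) ∅ k u v
    reach u v s with walk s
    ... | k , w rewrite index-pos t u | index-pos t v = k , w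

depth : ∀ {t} → Pos t → ℕ
depth top       = 0
depth (left p)  = suc (depth p)
depth (right p) = suc (depth p)

◁⇒depth< : ∀ {t} {p q : Pos t} → p ◁ q → depth p < depth q
◁⇒depth< (topˡ _)  = s≤s z≤n
◁⇒depth< (topʳ _)  = s≤s z≤n
◁⇒depth< (left e)  = s≤s (◁⇒depth< e)
◁⇒depth< (right e) = s≤s (◁⇒depth< e)

∼-shallower : ∀ {t} {p q : Pos t} → p ∼ q → depth p ≤ depth q → p ◁ q
∼-shallower (inj₁ e) _ = e
∼-shallower (inj₂ e) d = contradiction (<-≤-trans (◁⇒depth< e) d) (<-irrefl refl)

-- If the recursive call yields `nothing`, the position is the root of its subtree, and its parent
-- is `top`.
parent : ∀ {t} → Pos t → Maybe (Pos t)
parent top       = nothing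
parent (left p)  = just (maybe′ left top (parent p))
parent (right p) = just (maybe′ right top (parent p))

◁⇒parent : ∀ {t} {p q : Pos t} → p ◁ q → parent q ≡ just p
◁⇒parent (topˡ top) = refl
◁⇒parent (topʳ top) = refl
◁⇒parent (left e)   rewrite ◁⇒parent e = refl
◁⇒parent (right e)  rewrite ◁⇒parent e = refl

◁-unique : ∀ {t} {p p′ q : Pos t} → p ◁ q → p′ ◁ q → p ≡ p′
◁-unique e e′ = just-injective (trans (≡-sym (◁⇒parent e)) (◁⇒parent e′))

argmax : ∀ {n} (f : Fin (suc n) → ℕ) → ∃ λ i → ∀ j → f j ≤ f i
argmax {zero}  f = fzero , λ { fzero → ≤-refl }
argmax {suc n} f with argmax (f ∘ fsuc)
... | i , max with ≤-total (f fzero) (f (fsuc i))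
...   | inj₁ le = fsuc i , λ { fzero → le ; (fsuc j) → max j }
...   | inj₂ ge = fzero , λ { fzero → ≤-refl ; (fsuc j) → ≤-trans (max j) ge }

-- A deepest vertex of a cycle would have two different parents.
treeGraph-acyclic : ∀ t → ¬ HasCycle (treeGraph t)
treeGraph-acyclic t (k , c , c-injective , consecutive , closing) with argmax (depth ∘ pos t ∘ c)
... | i , deepest with neighbours i
  where
    E : Fin (3 + k) → Fin (3 + k) → Set
    E i j = pos t (c i) ∼ pos t (c j)

    next : ∀ i j → toℕ j ≡ suc (toℕ i) → E i j
    next i j e = adj⇒∼ t (consecutive i j e)

    close : E (fromℕ (2 + k)) fzero
    close = adj⇒∼ t closing

    neighbours : ∀ i → ∃ λ a → ∃ λ b → a ≢ b × E a i × E b i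
    neighbours fzero = fromℕ (2 + k) , fsuc fzero , (λ ()) , close , swap (next _ _ refl)
    -- Either the index has a successor, or it is the last one and the cycle closes at `fzero`.
    neighbours (fsuc i) with m≤n⇒m<n∨m≡n (toℕ<n (fsuc i))
    ... | inj₁ lt = inject₁ i , fromℕ< lt , apart , next _ _ (cong suc (≡-sym (toℕ-inject₁ i)))
                  , swap (next _ _ (toℕ-fromℕ< lt))
      where
        apart : inject₁ i ≢ fromℕ< lt
        apart e = <-irrefl (trans (≡-sym (toℕ-inject₁ i)) (trans (cong toℕ e) (toℕ-fromℕ< lt)))
                    (s≤s (n≤1+n _))
    ... | inj₂ eq = inject₁ i , fzero , apart , next _ _ (cong suc (≡-sym (toℕ-inject₁ i)))
                  , subst (λ j → E fzero j) last (swap close)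
      where
        last : fromℕ (2 + k) ≡ fsuc i
        last = toℕ-injective (trans (toℕ-fromℕ (2 + k)) (≡-sym (suc-injective eq)))
        apart : inject₁ i ≢ fzero
        -- Here `toℕ i` is `1 + k`, so the predecessor is not `fzero`: a cycle has at least three
        -- vertices.
        apart e with trans (≡-sym (toℕ-inject₁ i)) (cong toℕ e) | suc-injective (suc-injective eq)
        ... | e₁ | e₂ with trans (≡-sym e₁) e₂
        ...   | ()
... | a , b , a≢b , ea , eb =
  a≢b (c-injective (pos-injective t
    (◁-unique (∼-shallower ea (deepest a)) (∼-shallower eb (deepest b)))))

-- A list, so that `nil` needs no case distinction when roots become cops.
tops : ∀ t → List (Pos t)
tops nil        = []
tops (node _ _) = top ∷ []

∈-tops : ∀ {t} {p : Pos t} → IsTop p → p List.∈ tops t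
∈-tops top = here refl

length-tops : ∀ t → length (tops t) ≤ 1
length-tops nil        = z≤n
length-tops (node _ _) = ≤-refl

children : ∀ {t} → Pos t → List (Pos t)
children {node l r} top = map left (tops l) ++ map right (tops r)
children (left p)       = map left (children p)
children (right p)      = map right (children p)

∈-children : ∀ {t} {p q : Pos t} → p ◁ q → q List.∈ children p
∈-children (topˡ i)      = ∈-++⁺ˡ (∈-map⁺ left (∈-tops i))
∈-children {node l r} (topʳ i) = ∈-++⁺ʳ (map left (tops l)) (∈-map⁺ right (∈-tops i))
∈-children (left e)      = ∈-map⁺ left (∈-children e)
∈-children (right e)     = ∈-map⁺ right (∈-children e)

length-children : ∀ {t} (p : Pos t) → length (children p) ≤ 2
length-children {node nil        nil}        top = z≤n
length-children {node nil        (node _ _)} top = n≤1+n 1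
length-children {node (node _ _) nil}        top = n≤1+n 1
length-children {node (node _ _) (node _ _)} top = ≤-refl
length-children (left p)  = ≤-trans (≤-reflexive (length-map left (children p))) (length-children p)
length-children (right p) = ≤-trans (≤-reflexive (length-map right (children p))) (length-children p)

neighbours : ∀ {t} → Pos t → List (Pos t)
neighbours p = maybe′ (_∷ children p) (children p) (parent p)

∈-neighbours : ∀ {t} {p q : Pos t} → p ∼ q → q List.∈ neighbours p
∈-neighbours {p = p} (inj₁ e) with parent p
... | just _  = there (∈-children e)
... | nothing = ∈-children e
∈-neighbours (inj₂ e) rewrite ◁⇒parent e = here refl

length-neighbours : ∀ {t} (p : Pos t) → length (neighbours p) ≤ 3
length-neighbours p with parent p
... | just _  = s≤s (length-children p)
... | nothing = m≤n⇒m≤1+n (length-children p)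

treeGraph-subcubic : ∀ t → MaxDegree≤ 3 (treeGraph t)
treeGraph-subcubic t u = ≤-trans (p⊆q⇒∣p∣≤∣q∣ listed)
  (≤-trans (∣fromList∣ ns) (subst (_≤ 3) (≡-sym (length-map index (neighbours (pos t u)))) (length-neighbours (pos t u))))
  where
    ns = map index (neighbours (pos t u))

    listed : tabulate (adj (treeGraph t) u) ⊆ fromList ns
    listed {v} m = subst (_∈ fromList ns) (index-pos t v)
      (∈-fromList (∈-map⁺ index (∈-neighbours (adj⇒∼ t (∈-tabulate⁻ m)))))

treeGraph-isSubcubicTree : ∀ l r → IsSubcubicTree (treeGraph (node l r))
treeGraph-isSubcubicTree l r =
  (treeGraph-connected l r , treeGraph-acyclic (node l r)) , treeGraph-subcubic (node l r)

-- The blind cop strategy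

path : ℕ → Tree → Tree
path zero    s = s
path (suc j) s = node nil (path j s)

-- Bounds the length of the strategy clearing binaryTree h, whatever the radius.
duration : ℕ → ℕ
armLength : ℕ → ℕ

duration zero    = 1
duration (suc h) = duration h + (armLength h + (duration h + (1 + (armLength h + 1))))

-- At radius r ≤ h, contamination needs more than duration h turns to run down the arm.
armLength h = suc h * suc (duration h)

-- Splitting off the two branches makes `binaryTree h` a `node` even for a variable `h`.
binaryTree leftArm rightArm : ℕ → Tree
binaryTree h = node (leftArm h) (rightArm h)
leftArm zero     = nil
leftArm (suc h)  = path (armLength h) (binaryTree h)
rightArm zero    = nil
rightArm (suc h) = binaryTree h

1≤duration : ∀ h → 1 ≤ duration h
1≤duration zero    = ≤-refl
1≤duration (suc h) = ≤-trans (1≤duration h) (m≤m+n (duration h) _)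

size-mono : ∀ {g h} → g ≤ h → size (binaryTree g) ≤ size (binaryTree h)
size-mono {h = zero}  z≤n = ≤-refl
size-mono {h = suc h} g≤1+h with m≤n⇒m<n∨m≡n g≤1+h
... | inj₁ (s≤s g≤h) = ≤-trans (size-mono g≤h) (m≤n⇒m≤1+n (m≤n+m (size (binaryTree h)) (size (leftArm (suc h)))))
... | inj₂ refl      = ≤-refl

positions : ∀ t → List (Pos t)
positions nil        = []
positions (node l r) = top ∷ map left (positions l) ++ map right (positions r)

∈-positions : ∀ {t} (p : Pos t) → p List.∈ positions t
∈-positions top       = here refl
∈-positions (left p)  = there (∈-++⁺ˡ (∈-map⁺ left (∈-positions p)))
∈-positions {node l r} (right p) =
  there (∈-++⁺ʳ (map left (positions l)) (∈-map⁺ right (∈-positions p)))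

length-positions : ∀ t → length (positions t) ≡ size t
length-positions nil        = refl
length-positions (node l r) = cong suc (trans (length-++ (map left (positions l)))
  (cong₂ _+_ (trans (length-map left (positions l)) (length-positions l))
             (trans (length-map right (positions r)) (length-positions r))))

-- Subtrees and levels along an arm

infix 4 _⊑_

-- Records an occurrence of the subtree, built from the whole tree downwards, so that the recursive
-- strategy stays within one fixed tree `t`.
data _⊑_ : Tree → Tree → Set where
  whole : ∀ {t} → t ⊑ t
  left  : ∀ {l r t} → node l r ⊑ t → l ⊑ t
  right : ∀ {l r t} → node l r ⊑ t → r ⊑ t

emb : ∀ {s t} → s ⊑ t → Pos s → Pos t
emb whole     p = p
emb (left e)  p = emb e (left p)
emb (right e) p = emb e (right p)

-- The only edge leaving a subtree joins its root to the parent of the root. Hence one cop at the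
-- root seals the subtree.
emb-edge : ∀ {s t} (e : s ⊑ t) {x q} → q ∼ emb e x → (∃ λ y → q ≡ emb e y × y ∼ x) ⊎ IsTop x
emb-edge whole q∼x = inj₁ (_ , refl , q∼x)
emb-edge (left e) q∼x with emb-edge e q∼x
... | inj₁ (left y , eq , inj₁ (left y∼x))  = inj₁ (y , eq , inj₁ y∼x)
... | inj₁ (left y , eq , inj₂ (left x∼y))  = inj₁ (y , eq , inj₂ x∼y)
... | inj₁ (top    , eq , inj₁ (topˡ x-top)) = inj₂ x-top
emb-edge (right e) q∼x with emb-edge e q∼x
... | inj₁ (right y , eq , inj₁ (right y∼x)) = inj₁ (y , eq , inj₁ y∼x)
... | inj₁ (right y , eq , inj₂ (right x∼y)) = inj₁ (y , eq , inj₂ x∼y)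
... | inj₁ (top     , eq , inj₁ (topʳ x-top)) = inj₂ x-top

In : ∀ {s t} → s ⊑ t → Pos t → Set
In e p = ∃ λ x → p ≡ emb e x

roots : ∀ {s t} → s ⊑ t → List (Pos t)
roots {s} e = map (emb e) (tops s)

length-roots : ∀ {s t} (e : s ⊑ t) → length (roots e) ≤ 1
length-roots {s} e = ≤-trans (≤-reflexive (length-map (emb e) (tops s))) (length-tops s)

bottom : ∀ L {s t} → path L s ⊑ t → s ⊑ t
bottom zero    e = e
bottom (suc L) e = bottom L (right e)

-- Arms run along right children, so that Deep j means at least j levels down the arm.
data Deep : ℕ → ∀ {t} → Pos t → Set where
  zero : ∀ {t} {p : Pos t} → Deep zero p
  suc  : ∀ {j l r} {p : Pos r} → Deep j p → Deep (suc j) (right {l} {r} p)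

Deep-≤ : ∀ {i j t} {p : Pos t} → i ≤ j → Deep j p → Deep i p
Deep-≤ z≤n     _       = zero
Deep-≤ (s≤s i≤j) (suc d) = suc (Deep-≤ i≤j d)

Deep-edge : ∀ {j t} {p q : Pos t} → q ∼ p → Deep (suc j) p → Deep j q
Deep-edge {zero} _ _ = zero
Deep-edge {suc j} (inj₁ (topʳ top)) (suc ())
Deep-edge {suc j} (inj₁ (right e)) (suc d) = suc (Deep-edge (inj₁ e) d)
Deep-edge {suc j} (inj₂ (right e)) (suc d) = suc (Deep-edge (inj₂ e) d)

InDeep : ∀ {s t} → ℕ → s ⊑ t → Pos t → Set
InDeep j e p = ∃ λ x → p ≡ emb e x × Deep j x

-- A vertex of positive level is not the root of the subtree, so by `emb-edge` its neighbours lie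
-- inside as well.
InDeep-edge : ∀ {s t j p q} (e : s ⊑ t) → q ∼ p → InDeep (suc j) e p → InDeep j e q
InDeep-edge e q∼p (x , refl , d) with emb-edge e q∼p | d
... | inj₁ (y , refl , y∼x) | _ = y , refl , Deep-edge y∼x d
... | inj₂ () | suc _

bottom-InDeep : ∀ L {s t p} (e : path L s ⊑ t) → In (bottom L e) p → InDeep L e p
bottom-InDeep zero    e (x , refl) = x , refl , zero
bottom-InDeep (suc L) e m with bottom-InDeep L (right e) m
... | x , refl , d = right x , refl , suc d

-- The cops last placed, and the contaminated vertices.
State : ℕ → Set₁
State n = Subset n × (Fin n → Set)

module _ {n : ℕ} (G : Graph n) (ρ : ℕ) where

  turn : State n → Subset n → State n
  turn (C , A) C′ = C′ , λ u → u ∉ C′ × ∃ λ a → A a × Reach (adj G) (C ∩ C′) ρ a u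

  -- Unlike `escape`, keeps the last cop set, so that strategies can be concatenated.
  play : State n → List (Subset n) → State n
  play st []       = st
  play st (C ∷ Cs) = play (turn st C) Cs

  escape≡play : ∀ C A Cs → escape G ρ C A Cs ≡ proj₂ (play (C , A) Cs)
  escape≡play C A []       = refl
  escape≡play C A (D ∷ Cs) = escape≡play D _ Cs

copSet : ∀ {t} → List (Pos t) → Subset (size t)
copSet ps = fromList (map index ps)

∣copSet∣ : ∀ {t} (ps : List (Pos t)) → ∣ copSet ps ∣ ≤ length ps
∣copSet∣ ps = ≤-trans (∣fromList∣ (map index ps)) (≤-reflexive (length-map index ps))

∈-copSet : ∀ {t} {p : Pos t} {ps} → p List.∈ ps → index p ∈ copSet ps
∈-copSet m = ∈-fromList (∈-map⁺ index m)

infixr 6 _∪ₚ_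

_∪ₚ_ : ∀ {t} → (Pos t → Set) → (Pos t → Set) → Pos t → Set
(D ∪ₚ D′) p = D p ⊎ D′ p

∅ₚ : ∀ {t} → Pos t → Set
∅ₚ _ = ⊥

-- `X` contains the inner boundary of `D`, so cops on `X` seal `D` off.
Gated : ∀ {t} → (Pos t → Set) → List (Pos t) → Set
Gated D X = ∀ {p q} → D q → p ∼ q → D p ⊎ q List.∈ X

Gated-∪ : ∀ {t} {D D′ : Pos t → Set} {X X′} → Gated D X → Gated D′ X′ → Gated (D ∪ₚ D′) (X ++ X′)
Gated-∪ g g′ (inj₁ d) e = Sum.map inj₁ ∈-++⁺ˡ (g d e)
Gated-∪ {X = X} g g′ (inj₂ d) e = Sum.map inj₂ (∈-++⁺ʳ X) (g′ d e)

Gated-In : ∀ {s t} (e : s ⊑ t) → Gated (In e) (roots e)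
Gated-In e (x , refl) p∼q with emb-edge e p∼q
... | inj₁ (y , refl , _) = inj₁ (y , refl)
... | inj₂ x-top          = inj₂ (∈-map⁺ (emb e) (∈-tops x-top))

Gated-∅ : ∀ {t} → Gated {t} ∅ₚ []
Gated-∅ ()

module Strategy (t : Tree) (ρ : ℕ) where

  G : Graph (size t)
  G = treeGraph t

  Cops : Set
  Cops = List (Pos t)

  run-cops : State (size t) → List Cops → State (size t)
  run-cops st Cs = play G ρ st (map copSet Cs)

  Clean : State (size t) → (Pos t → Set) → Set
  Clean st D = ∀ u → D (pos t u) → ¬ proj₂ st u

  Guarded : State (size t) → Cops → Set
  Guarded st X = ∀ {p} → p List.∈ X → index p ∈ proj₁ st

  Held : State (size t) → (Pos t → Set) → Cops → Set
  Held st D X = Clean st D × Guarded st X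

  -- Followed backwards from its end in `D`, the walk could leave `D` only from a vertex of `X`, and
  -- it avoids those.
  no-entry : ∀ {D X Y k a u} → Gated D X → (∀ {p} → p List.∈ X → index p ∈ Y) →
             Reach (adj G) Y k a u → D (pos t u) → D (pos t a)
  no-entry g X⊆Y (stay _) d = d
  no-entry {Y = Y} g X⊆Y (move {u = a} {v = v} _ e w) d
    with g (no-entry g X⊆Y w d) (adj⇒∼ t e)
  ... | inj₁ da  = da
  ... | inj₂ v∈X = contradiction (subst (_∈ Y) (index-pos t v) (X⊆Y v∈X)) (start∉ w)
    where
      start∉ : ∀ {k v u} → Reach (adj G) Y k v u → v ∉ Y
      start∉ (stay v∉)     = v∉
      start∉ (move v∉ _ _) = v∉

  -- The gate `X` is occupied both before and after the turn, hence lies in the intersection that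
  -- blocks walks, and nothing enters `D`. The new region may also use the vertices of `C`.
  advance : ∀ {st D X D′ X′} C → Gated D X → Held st D X → (∀ {p} → p List.∈ X → p List.∈ C) →
            (∀ {p} → D′ p → D p ⊎ p List.∈ C) → (∀ {p} → p List.∈ X′ → p List.∈ C) →
            Held (turn G ρ st (copSet C)) D′ X′
  advance {st = st} {D′ = D′} C gate (clean , guarded) X⊆C D′⊆ X′⊆C = clean′ , ∈-copSet ∘ X′⊆C
    where
      clean′ : Clean (turn G ρ st (copSet C)) D′
      clean′ u d′ (u∉C , a , Aa , w) with D′⊆ d′
      ... | inj₁ d = clean a (no-entry gate (λ m → x∈p∩q⁺ (guarded m , ∈-copSet (X⊆C m))) w d) Aa
      ... | inj₂ m = u∉C (subst (_∈ copSet C) (index-pos t u) (∈-copSet m))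

  reach-InDeep : ∀ {s j k a u Y} (e : s ⊑ t) → Reach (adj G) Y k a u →
                 InDeep (k + j) e (pos t u) → InDeep j e (pos t a)
  reach-InDeep {j = j} {k} e (stay _) (x , eq , d) = x , eq , Deep-≤ (m≤n+m j k) d
  reach-InDeep {j = j} {suc k} {u = u} e (move _ a∼v w) m =
    InDeep-edge e (adj⇒∼ t a∼v)
      (reach-InDeep e w (subst (λ i → InDeep i e (pos t u)) (≡-sym (+-suc k j)) m))

  -- Unguarded, a clean subtree loses at most ρ levels per turn.
  decay : ∀ {s st j} (e : s ⊑ t) Cs → Clean st (InDeep j e) →
          Clean (run-cops st Cs) (InDeep (length Cs * ρ + j) e)
  decay e [] clean = clean
  decay {st = st} {j = j} e (C ∷ Cs) clean =
    subst (λ i → Clean (run-cops st′ Cs) (InDeep i e)) shift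
      (decay {st = st′} {j = ρ + j} e Cs
        λ { u d (_ , a , Aa , w) → clean a (reach-InDeep e w d) Aa })
    where
      st′ = turn G ρ st (copSet C)

      shift : length Cs * ρ + (ρ + j) ≡ (ρ + length Cs * ρ) + j
      shift = trans (≡-sym (+-assoc (length Cs * ρ) ρ j)) (cong (_+ j) (+-comm (length Cs * ρ) ρ))

  run-++ : ∀ st Cs Ds → run-cops st (Cs ++ Ds) ≡ run-cops (run-cops st Cs) Ds
  run-++ st []       Ds = refl
  run-++ st (C ∷ Cs) Ds = run-++ (turn G ρ st (copSet C)) Cs Ds

  SmallCops : ℕ → List Cops → Set
  SmallCops k = All (λ C → length C ≤ k)

  -- Moves up the arm from its bottom. Each cop set contains `X`, the current front and the parent
  -- of the front, so the gate stays closed while the front advances.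
  sweep : Cops → ∀ L {s} → path L s ⊑ t → List Cops
  sweep X zero    e = []
  sweep X (suc L) e = sweep X L (right e) ++ (((X ++ roots (right e)) ++ roots e) ∷ [])

  length-sweep : ∀ X L {s} (e : path L s ⊑ t) → length (sweep X L e) ≡ L
  length-sweep X zero    e = refl
  length-sweep X (suc L) e =
    trans (length-++ (sweep X L (right e))) (trans (+-comm _ 1) (cong suc (length-sweep X L (right e))))

  length-three : ∀ {s s′ X} (e : s ⊑ t) (e′ : s′ ⊑ t) → length X ≤ 1 →
                 length ((X ++ roots e) ++ roots e′) ≤ 3
  length-three {X = X} e e′ X≤1 = ≤-trans (≤-reflexive (length-++ (X ++ roots e)))
    (+-mono-≤ {y = 2} (≤-trans (≤-reflexive (length-++ X)) (+-mono-≤ X≤1 (length-roots e))) (length-roots e′))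

  small-sweep : ∀ {k X} → length X ≤ 1 → ∀ L {s} (e : path L s ⊑ t) → SmallCops (3 + k) (sweep X L e)
  small-sweep X≤1 zero    e = []
  small-sweep {X = X} X≤1 (suc L) e = All.++⁺ (small-sweep X≤1 L (right e))
    (≤-trans (length-three {X = X} (right e) e X≤1) (m≤m+n 3 _) ∷ [])

  -- `Q` is a region elsewhere that the cops on `X` keep clean meanwhile: empty in the first sweep,
  -- the upper copy in the second.
  sweep-held : ∀ {Q X} → Gated Q X → ∀ L {s st} (e : path L s ⊑ t) →
               Held st (Q ∪ₚ In (bottom L e)) (X ++ roots (bottom L e)) →
               Held (run-cops st (sweep X L e)) (Q ∪ₚ In e) (X ++ roots e)
  sweep-held gate zero e held = held
  sweep-held {Q} {X} gate (suc L) {st = st} e held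
    rewrite run-++ st (sweep X L (right e)) (((X ++ roots (right e)) ++ roots e) ∷ [])
    = advance {st = run-cops st (sweep X L (right e))} {D′ = Q ∪ₚ In e} _
        (Gated-∪ {X = X} gate (Gated-In (right e)))
        (sweep-held gate L (right e) held) ∈-++⁺ˡ covered
        ([ ∈-++⁺ˡ ∘ ∈-++⁺ˡ , ∈-++⁺ʳ (X ++ roots (right e)) ]′ ∘ ∈-++⁻ X)
    where
      covered : ∀ {p} → (Q ∪ₚ In e) p →
                (Q ∪ₚ In (right e)) p ⊎ p List.∈ (X ++ roots (right e)) ++ roots e
      covered (inj₁ q)                 = inj₁ (inj₁ q)
      covered (inj₂ (top , refl))      = inj₂ (∈-++⁺ʳ (X ++ roots (right e)) (here refl))
      covered (inj₂ (right x , refl))  = inj₁ (inj₂ (x , refl))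

  -- Quantified over all states, so that such a strategy can follow any other.
  Clears : ∀ {s} → s ⊑ t → List Cops → Set₁
  Clears e Cs = ∀ st → Held (run-cops st Cs) (In e) (roots e)

  clears-cover : ∀ {s} (e : s ⊑ t) → Clears e (map (emb e) (positions s) ∷ [])
  clears-cover e st = advance {st = st} {D = ∅ₚ} {X = []} {D′ = In e} _ Gated-∅ ((λ _ ()) , λ ()) (λ ())
    (λ { (x , refl) → inj₂ (∈-map⁺ (emb e) (∈-positions x)) })
    (λ m → let x , _ , eq = ∈-map⁻ (emb e) m in subst (List._∈ _) (≡-sym eq) (∈-map⁺ (emb e) (∈-positions x)))

  -- The arm is left unguarded during `Ds` and during one more turn, the one to `block`, whence the
  -- `suc`. In that time contamination of speed `ρ` cannot run down an arm of length `L`, so the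
  -- subtree at its bottom is still clean and the second sweep can start there.
  clears-node : ∀ {L l r Cs Ds} (e : node (path L l) r ⊑ t) →
                suc (length Ds) * ρ ≤ L → Clears (bottom L (left e)) Cs → Clears (right e) Ds →
                Clears e (Cs ++ sweep [] L (left e) ++ Ds ++ (roots (right e) ++ roots (bottom L (left e))) ∷
                          sweep (roots (right e)) L (left e) ++
                          ((roots (right e) ++ roots (left e)) ++ roots e) ∷ [])
  clears-node {L} {l} {r} {Cs} {Ds} e long clearsCs clearsDs st =
    subst (λ st → Held st (In e) (roots e)) (≡-sym split) held₅
    where
      a  = left e
      a₀ = bottom L a
      b  = right e
      sweep₁ = sweep [] L a
      sweep₂ = sweep (roots b) L a
      block  = roots b ++ roots a₀
      merge  = (roots b ++ roots a) ++ roots e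
      st₁ = run-cops st Cs
      st₂ = run-cops st₁ sweep₁
      st₃ = run-cops st₂ Ds
      st₄ = turn G ρ st₃ (copSet block)
      st₅ = run-cops st₄ sweep₂

      split : run-cops st (Cs ++ sweep₁ ++ Ds ++ block ∷ sweep₂ ++ merge ∷ []) ≡ turn G ρ st₅ (copSet merge)
      split = trans (run-++ st Cs _) (trans (run-++ st₁ sweep₁ _)
        (trans (run-++ st₂ Ds _) (run-++ st₄ sweep₂ _)))

      held₂ : Held st₂ (∅ₚ ∪ₚ In a) (roots a)
      held₂ = sweep-held {Q = ∅ₚ} {X = []} Gated-∅ L {st = st₁} a
        ((λ u → λ { (inj₂ m) → proj₁ (clearsCs st) u m }) , proj₂ (clearsCs st))

      decayed : Clean st₄ (InDeep L a)
      decayed u (x , eq , d) =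
        subst (λ st → Clean st (InDeep (length (Ds ++ block ∷ []) * ρ + 0) a)) (run-++ st₂ Ds (block ∷ []))
          -- Level `0` is the whole left branch, clean after the first sweep.
          (decay {st = st₂} {j = 0} a (Ds ++ block ∷ []) λ { v (y , eq′ , _) → proj₁ held₂ v (inj₂ (y , eq′)) })
          u (x , eq , Deep-≤ (≤-trans (≤-reflexive short) long) d)
        where
          short : length (Ds ++ block ∷ []) * ρ + 0 ≡ suc (length Ds) * ρ
          short = trans (+-identityʳ _)
            (cong (_* ρ) (trans (length-++ Ds) (+-comm (length Ds) 1)))

      -- `held-b` already provides all guards of `block`; the bottom subtree owes its cleanness to
      -- `decayed`.
      held₄ : Held st₄ (In b ∪ₚ In a₀) block
      held₄ = (λ { u (inj₁ m) → proj₁ held-b u m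
                 ; u (inj₂ m) → decayed u (bottom-InDeep L a m) }) , proj₂ held-b
        where
          held-b : Held st₄ (In b) block
          held-b = advance {st = st₃} {D = In b} {D′ = In b} block (Gated-In b) (clearsDs st₂) ∈-++⁺ˡ inj₁ id

      held₅ : Held (turn G ρ st₅ (copSet merge)) (In e) (roots e)
      held₅ = advance {st = st₅} {D = In b ∪ₚ In a} {D′ = In e} merge
        (Gated-∪ {X = roots b} (Gated-In b) (Gated-In a))
        (sweep-held {Q = In b} {X = roots b} (Gated-In b) L {st = st₄} a held₄)
        ∈-++⁺ˡ covered (∈-++⁺ʳ (roots b ++ roots a))
        where
          covered : ∀ {p} → In e p → (In b ∪ₚ In a) p ⊎ p List.∈ merge
          covered (top     , refl) = inj₂ (∈-++⁺ʳ (roots b ++ roots a) (here refl))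
          covered (left x  , refl) = inj₁ (inj₂ (x , refl))
          covered (right x , refl) = inj₁ (inj₁ (x , refl))

  -- Trees of height at most `ρ` are covered entirely; every other cop set has at most three
  -- vertices.
  maxCops : ℕ
  maxCops = 3 + size (binaryTree ρ)

  clear : ∀ h (e : binaryTree h ⊑ t) →
          ∃ λ Cs → length Cs ≤ duration h × SmallCops maxCops Cs × Clears e Cs
  clear-small : ∀ {h} → h ≤ ρ → 1 ≤ duration h → (e : binaryTree h ⊑ t) →
          ∃ λ Cs → length Cs ≤ duration h × SmallCops maxCops Cs × Clears e Cs
  clear-small {h} h≤ρ 1≤d e = map (emb e) (positions (binaryTree h)) ∷ [] , 1≤d , small ∷ [] , clears-cover e
    where
      small : length (map (emb e) (positions (binaryTree h))) ≤ maxCops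
      small = ≤-trans (≤-reflexive (trans (length-map (emb e) (positions (binaryTree h))) (length-positions (binaryTree h))))
        (≤-trans (size-mono h≤ρ) (m≤n+m _ 3))

  clear zero e = clear-small z≤n ≤-refl e
  clear (suc h) e with suc h ≤? ρ
  ... | yes h<ρ = clear-small h<ρ (1≤duration (suc h)) e
  ... | no h≮ρ with clear h (bottom (armLength h) (left e)) | clear h (right e)
  ...   | Cs , lenC , smallC , clearsC | Ds , lenD , smallD , clearsD =
    _ , total , small , clears-node {L = L} {Cs = Cs} {Ds} e long clearsC clearsD
    where
      L  = armLength h
      a  = left e
      a₀ = bottom L a
      b  = right e

      -- Since `suc h ≤ ρ` fails, `ρ ≤ h`, and the factor `suc h` of `armLength h` is large enough.
      long : suc (length Ds) * ρ ≤ L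
      long = ≤-trans (*-mono-≤ (s≤s lenD) (s≤s⁻¹ (≰⇒> h≮ρ)))
        (≤-trans (≤-reflexive (*-comm (suc (duration h)) h)) (*-monoˡ-≤ (suc (duration h)) (n≤1+n h)))

      sweep₁ = sweep [] L a
      sweep₂ = sweep (roots b) L a
      block  = roots b ++ roots a₀
      merge  = (roots b ++ roots a) ++ roots e

      -- The summands follow the recursion of `duration`: lower copy, sweep, upper copy, `block`,
      -- sweep, `merge`.
      length≡ : length (Cs ++ sweep₁ ++ Ds ++ block ∷ sweep₂ ++ merge ∷ []) ≡
                length Cs + (L + (length Ds + (1 + (L + 1))))
      length≡ = trans (length-++ Cs) (cong (length Cs +_)
        (trans (length-++ sweep₁) (cong₂ _+_ (length-sweep [] L a)
        (trans (length-++ Ds) (cong (length Ds +_) (cong suc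
        (trans (length-++ sweep₂) (cong (_+ 1) (length-sweep (roots b) L a)))))))))

      total : length (Cs ++ sweep₁ ++ Ds ++ block ∷ sweep₂ ++ merge ∷ []) ≤ duration (suc h)
      total = ≤-trans (≤-reflexive length≡)
        (+-mono-≤ lenC (+-monoʳ-≤ L (+-monoˡ-≤ (1 + (L + 1)) lenD)))

      small : SmallCops maxCops (Cs ++ sweep₁ ++ Ds ++ block ∷ sweep₂ ++ merge ∷ [])
      small = All.++⁺ smallC (All.++⁺ (small-sweep z≤n L a) (All.++⁺ smallD
        (≤-trans (length-three {X = []} b a₀ z≤n) (m≤m+n 3 _)
        ∷ All.++⁺ (small-sweep (length-roots b) L a)
            (≤-trans (length-three {X = roots b} a e (length-roots b)) (m≤m+n 3 _) ∷ []))))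

binaryTree-bcw : ∀ r h → bcw≤ r (treeGraph (binaryTree h)) (3 + size (binaryTree r))
binaryTree-bcw r h = ∅ , map copSet Cs , small , win
  where
    open Strategy (binaryTree h) r
    strategy = clear h whole
    Cs = proj₁ strategy

    small : All (λ C → ∣ C ∣ ≤ maxCops) (∅ ∷ map copSet Cs)
    small = ≤-trans (≤-reflexive (∣⊥∣≡0 (size (binaryTree h)))) z≤n
          ∷ All.map⁺ (All.map (λ {C} → ≤-trans (∣copSet∣ C)) (proj₁ (proj₂ (proj₂ strategy))))

    win : ∀ u → ¬ escape G r ∅ (_∉ ∅) (map copSet Cs) u
    win u esc = proj₁ (proj₂ (proj₂ (proj₂ strategy)) (∅ , (_∉ ∅))) u (pos _ u , refl)
      (subst (λ A → A u) (escape≡play G r ∅ (_∉ ∅) (map copSet Cs)) esc)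

-- From cops to flips

elements : ∀ {n} → Subset n → List (Fin n)
elements []            = []
elements (inside ∷ p)  = fzero ∷ map fsuc (elements p)
elements (outside ∷ p) = map fsuc (elements p)

∈-elements : ∀ {n} {x : Fin n} {p} → x ∈ p → x List.∈ elements p
∈-elements {p = inside ∷ p}  here      = here refl
∈-elements {p = inside ∷ p}  (there m) = there (∈-map⁺ fsuc (∈-elements m))
∈-elements {p = outside ∷ p} (there m) = ∈-map⁺ fsuc (∈-elements m)

length-elements : ∀ {n} (p : Subset n) → length (elements p) ≡ ∣ p ∣
length-elements []            = refl
length-elements (inside ∷ p)  = cong suc (trans (length-map fsuc (elements p)) (length-elements p))
length-elements (outside ∷ p) = trans (length-map fsuc (elements p)) (length-elements p)

length-concatMap : ∀ {A B : Set} {f : A → List B} {d} → (∀ x → length (f x) ≤ d) →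
                   ∀ xs → length (concatMap f xs) ≤ length xs * d
length-concatMap         f≤d []       = z≤n
length-concatMap {f = f} f≤d (x ∷ xs) =
  ≤-trans (≤-reflexive (length-++ (f x))) (+-mono-≤ (f≤d x) (length-concatMap f≤d xs))

neighbourhood : ∀ {n} → Graph n → Fin n → List (Fin n)
neighbourhood G v = elements (tabulate (adj G v))

∈-neighbourhood : ∀ {n} (G : Graph n) {u v} → adj G u v ≡ true → v List.∈ neighbourhood G u
∈-neighbourhood G e = ∈-elements (∈-tabulate⁺ e)

closedNeighbourhood : ∀ {n} → Graph n → Subset n → List (Fin n)
closedNeighbourhood G C = elements C ++ concatMap (neighbourhood G) (elements C)

length-closedNeighbourhood : ∀ {n d k} (G : Graph n) → MaxDegree≤ d G → ∀ C → ∣ C ∣ ≤ k →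
                             length (closedNeighbourhood G C) ≤ k + k * d
length-closedNeighbourhood {d = d} G deg C C≤k =
  ≤-trans (≤-reflexive (length-++ (elements C)))
    (+-mono-≤ C′≤k (≤-trans (length-concatMap degree≤d (elements C)) (*-monoˡ-≤ d C′≤k)))
  where
    C′≤k = ≤-trans (≤-reflexive (length-elements C)) C≤k

    degree≤d : ∀ v → length (neighbourhood G v) ≤ d
    degree≤d v = ≤-trans (≤-reflexive (length-elements (tabulate (adj G v)))) (deg v)

-- find sends the vertices outside the list to the part just after those of the list.
find : ∀ {n K} (xs : List (Fin n)) → length xs ≤ K → Fin n → Fin (suc K)
find []       _       v = fzero
find (x ∷ xs) (s≤s b) v with v Fin.≟ x
... | yes _ = fzero
... | no  _ = fsuc (find xs b v)

-- Recovers the vertex of a singleton part; `nothing` stands for the part of all vertices outside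
-- the list.
representative : ∀ {n m} → List (Fin n) → Fin m → Maybe (Fin n)
representative []       _        = nothing
representative (x ∷ xs) fzero    = just x
representative (x ∷ xs) (fsuc i) = representative xs i

representative-find : ∀ {n K} xs (b : length xs ≤ K) (v : Fin n) →
  representative xs (find xs b v) ≡ just v ⊎
  (¬ v List.∈ xs × representative xs (find xs b v) ≡ nothing)
representative-find []       _       v = inj₂ ((λ ()) , refl)
representative-find (x ∷ xs) (s≤s b) v with v Fin.≟ x
... | yes refl = inj₁ refl
... | no v≢x with representative-find xs b v
...   | inj₁ eq         = inj₁ eq
...   | inj₂ (v∉xs , eq) = inj₂ ((λ { (here e) → v≢x e ; (there m) → v∉xs m }) , eq)

module _ {n : ℕ} (G : Graph n) where

  -- Selects the edges of `G` that meet `C`. Both ends of such an edge lie in the closed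
  -- neighbourhood, so pairs involving the common part stay unflipped.
  edgeAt : Subset n → Maybe (Fin n) → Maybe (Fin n) → Bool
  edgeAt C (just a) (just b) = (lookup C a ∨ lookup C b) ∧ adj G a b
  edgeAt C (just a) nothing  = false
  edgeAt C nothing  _        = false

  edgeAt-sym : ∀ C a b → edgeAt C a b ≡ edgeAt C b a
  edgeAt-sym C (just a) (just b) = cong₂ _∧_ (∨-comm (lookup C a) (lookup C b)) (Graph.sym G a b)
  edgeAt-sym C (just a) nothing  = refl
  edgeAt-sym C nothing  (just b) = refl
  edgeAt-sym C nothing  nothing  = refl

  isolate : ∀ {K} C → length (closedNeighbourhood G C) ≤ K → Flip n (suc K)
  isolate C b = record
    { part  = find (closedNeighbourhood G C) b
    ; F     = λ P Q → edgeAt C (representative (closedNeighbourhood G C) P)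
                               (representative (closedNeighbourhood G C) Q)
    ; F-sym = λ P Q → edgeAt-sym C (representative (closedNeighbourhood G C) P)
                                   (representative (closedNeighbourhood G C) Q)
    }

  lookup⇒∉ : ∀ {C : Subset n} {u} → lookup C u ≡ false → u ∉ C
  lookup⇒∉ eq m with trans (≡-sym eq) ([]=⇒lookup m)
  ... | ()

  xor-cancel : ∀ a b c → a xor ((b ∨ c) ∧ a) ≡ true → b ≡ false × c ≡ false × a ≡ true
  xor-cancel true  false false _ = refl , refl , refl
  xor-cancel true  false true  ()
  xor-cancel true  true  _     ()
  xor-cancel false false false ()
  xor-cancel false false true  ()
  xor-cancel false true  _     ()

  ∉-closedNeighbourhood : ∀ {C u v} → ¬ u List.∈ closedNeighbourhood G C → adj G u v ≡ true →
                          u ∉ C × v ∉ C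
  ∉-closedNeighbourhood {C} {u} {v} u∉ e = (λ u∈C → u∉ (∈-++⁺ˡ (∈-elements u∈C))) , λ v∈C →
    u∉ (∈-++⁺ʳ (elements C) (∈-concatMap⁺ (neighbourhood G)
      (lose (∈-elements v∈C) (∈-neighbourhood G (trans (Graph.sym G v u) e)))))

  -- The flip toggles exactly the edges of `G` meeting `C`, which lie between singleton parts. It
  -- deletes them and creates no new edge.
  isolate-edge : ∀ {K} C (b : length (closedNeighbourhood G C) ≤ K) u v →
                 flipAdj G (isolate C b) u v ≡ true → u ∉ C × v ∉ C × adj G u v ≡ true
  isolate-edge C b u v e with u Fin.≟ v
  ... | no _ with representative-find (closedNeighbourhood G C) b u
                | representative-find (closedNeighbourhood G C) b v
  ...   | inj₁ eu | inj₁ ev rewrite eu | ev =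
    let u∉ , v∉ , u∼v = xor-cancel (adj G u v) (lookup C u) (lookup C v) e
    in lookup⇒∉ u∉ , lookup⇒∉ v∉ , u∼v
  ...   | inj₁ eu | inj₂ (v∉ , ev) rewrite eu | ev | xor-identityʳ (adj G u v) =
    let v∉C , u∉C = ∉-closedNeighbourhood v∉ (trans (Graph.sym G v u) e) in u∉C , v∉C , e
  ...   | inj₂ (u∉ , eu) | _ rewrite eu | xor-identityʳ (adj G u v) =
    let u∉C , v∉C = ∉-closedNeighbourhood u∉ e in u∉C , v∉C , e

  module _ {K : ℕ} (r : ℕ) where

    Small : Subset n → Set
    Small C = length (closedNeighbourhood G C) ≤ K

    flips : ∀ {Cs} → All Small Cs → List (Flip n (suc K))
    flips = All.reduce (λ {C} → isolate C)

    -- Walks in the flipped graph avoid all of `C`, in particular `C ∩ C′`, and non-isolated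
    -- vertices of the next graph avoid `C′`. Hence the invariant `R ⊆ A` survives each turn.
    remaining⊆escape : ∀ {Cs C E} {R A : Fin n → Set} (small : All Small Cs) →
      (∀ u v → E u v ≡ true → u ∉ C × v ∉ C × adj G u v ≡ true) →
      (∀ {u} → R u → A u) → (∀ {u} → A u → u ∉ C) →
      ∀ {u} → remaining G r E R (flips small) u → escape G r C A Cs u
    remaining⊆escape [] avoid R⊆A A∌C m = R⊆A m
    remaining⊆escape {C′ ∷ Cs} {C} {E} {R} {A} (b ∷ small) avoid R⊆A A∌C =
      remaining⊆escape small (isolate-edge C′ b) R⊆A′ proj₁
      where
        walk : ∀ {k a u} → a ∉ C → Reach E ∅ k a u → Reach (adj G) (C ∩ C′) k a u
        walk a∉C (stay _) = stay (a∉C ∘ proj₁ ∘ x∈p∩q⁻ C C′)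
        walk a∉C (move _ e w) with avoid _ _ e
        ... | _ , v∉C , a∼v = move (a∉C ∘ proj₁ ∘ x∈p∩q⁻ C C′) a∼v (walk v∉C w)

        R⊆A′ : ∀ {u} → NonIsolated (flipAdj G (isolate C′ b)) u × (∃ λ a → R a × Reach E ∅ r a u) →
               u ∉ C′ × ∃ λ a → A a × Reach (adj G) (C ∩ C′) r a u
        R⊆A′ ((v , e) , a , Ra , w) =
          proj₁ (isolate-edge C′ b _ v e) , a , R⊆A Ra , walk (A∌C (R⊆A Ra)) w

-- Flipping the singletons of a cop set and of its neighbours isolates the cop set.
bcw⇒bfw : ∀ {n r k d} (G : Graph n) → MaxDegree≤ d G → bcw≤ r G k → bfw≤ r G (suc (k + k * d))
bcw⇒bfw {n} {r} G deg (C , Cs , C≤k ∷ Cs≤k , win) =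
  -- The flip for `C` stands for the initial cop placement: vertices non-isolated after it lie
  -- outside `C`.
  flips G r {Cs = C ∷ Cs} (b ∷ small) , λ u m → win u (remaining⊆escape G r {Cs = Cs} {C = C} small (isolate-edge G C b)
    (λ { ((v , e) , _) → proj₁ (isolate-edge G C b _ v e) }) id m)
  where
    b     = length-closedNeighbourhood G deg C C≤k
    small = All.map (λ {C} → length-closedNeighbourhood G deg C) Cs≤k

-- Lower bounds for linear layouts

infix 4 _≽_

-- q ≽ p : q is an ancestor of p, or p itself
data _≽_ : ∀ {t} → Pos t → Pos t → Set where
  top   : ∀ {l r} {p : Pos (node l r)} → top ≽ p
  left  : ∀ {l r} {p q : Pos l} → q ≽ p → left {l} {r} q ≽ left p
  right : ∀ {l r} {p q : Pos r} → q ≽ p → right {l} {r} q ≽ right p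

rootOf-≽ : ∀ {t} (p : Pos t) → rootOf p ≽ p
rootOf-≽ top       = top
rootOf-≽ (left _)  = top
rootOf-≽ (right _) = top

-- With f the order of appearance in a linear layout, the active vertices at time τ are those
-- that a bag for the time τ has to contain.
Active : ∀ {t} → (Pos t → ℕ) → ℕ → Pos t → Set
Active f τ p = f p ≤ τ × ∃ λ q → (q ≡ p ⊎ p ∼ q) × τ ≤ f q

Active-map : ∀ {s t} (ι : Pos s → Pos t) → (∀ {p q} → p ∼ q → ι p ∼ ι q) →
             ∀ {f τ p} → Active (f ∘ ι) τ p → Active f τ (ι p)
Active-map ι ι-∼ (low , q , near , high) = low , ι q , Sum.map (cong ι) ι-∼ near , high

left-∼ : ∀ {l r} {p q : Pos l} → p ∼ q → left {l} {r} p ∼ left q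
left-∼ = Sum.map left left

right-∼ : ∀ {l r} {p q : Pos r} → p ∼ q → right {l} {r} p ∼ right q
right-∼ = Sum.map right right

module _ {t : Tree} (f : Pos t → ℕ) (τ : ℕ) where

  ActiveAbove : Pos t → Set
  ActiveAbove p = ∃ λ q → q ≽ p × Active f τ q

-- Climb to the root. A vertex before `τ` whose parent is not before `τ` is active; so is `p` itself
-- if it appears exactly at `τ`.
ascend-low : ∀ {t} (f : Pos t → ℕ) τ p → f p ≤ τ → ActiveAbove f τ p ⊎ f (rootOf p) < τ
ascend-low f τ top low with m≤n⇒m<n∨m≡n low
... | inj₁ lt   = inj₂ lt
... | inj₂ refl = inj₁ (top , top , ≤-refl , top , inj₁ refl , ≤-refl)
ascend-low f τ (left p) low with ascend-low (f ∘ left) τ p low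
... | inj₁ (q , q≽p , active) = inj₁ (left q , left q≽p , Active-map left left-∼ {f = f} active)
... | inj₂ lt with f top <? τ
...   | yes lt′ = inj₂ lt′
...   | no ge   = inj₁ (left (rootOf p) , left (rootOf-≽ p)
                       , <⇒≤ lt , top , inj₂ (inj₂ (topˡ (rootOf-IsTop p))) , ≮⇒≥ ge)
ascend-low f τ (right p) low with ascend-low (f ∘ right) τ p low
... | inj₁ (q , q≽p , active) = inj₁ (right q , right q≽p , Active-map right right-∼ {f = f} active)
... | inj₂ lt with f top <? τ
...   | yes lt′ = inj₂ lt′
...   | no ge   = inj₁ (right (rootOf p) , right (rootOf-≽ p)
                       , <⇒≤ lt , top , inj₂ (inj₂ (topʳ (rootOf-IsTop p))) , ≮⇒≥ ge)

-- Dually, a parent before `τ` of a vertex not before `τ` is active.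
ascend-high : ∀ {t} (f : Pos t → ℕ) τ p → τ ≤ f p → ActiveAbove f τ p ⊎ τ ≤ f (rootOf p)
ascend-high f τ top high = inj₂ high
ascend-high f τ (left p) high with ascend-high (f ∘ left) τ p high
... | inj₁ (q , q≽p , active) = inj₁ (left q , left q≽p , Active-map left left-∼ {f = f} active)
... | inj₂ ge with f top <? τ
...   | no ge′  = inj₂ (≮⇒≥ ge′)
...   | yes lt  = inj₁ (top , top , <⇒≤ lt , left (rootOf p) , inj₂ (inj₁ (topˡ (rootOf-IsTop p))) , ge)
ascend-high f τ (right p) high with ascend-high (f ∘ right) τ p high
... | inj₁ (q , q≽p , active) = inj₁ (right q , right q≽p , Active-map right right-∼ {f = f} active)
... | inj₂ ge with f top <? τ
...   | no ge′  = inj₂ (≮⇒≥ ge′)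
...   | yes lt  = inj₁ (top , top , <⇒≤ lt , right (rootOf p) , inj₂ (inj₁ (topʳ (rootOf-IsTop p))) , ge)

-- If both climbs met no active vertex, the root would be both before `τ` and not before `τ`.
bridge : ∀ {t} (f : Pos t → ℕ) τ p q → f p ≤ τ → τ ≤ f q → ActiveAbove f τ p ⊎ ActiveAbove f τ q
bridge f τ p q low high with ascend-low f τ p low | ascend-high f τ q high
... | inj₁ above | _          = inj₁ above
... | inj₂ _     | inj₁ above = inj₂ above
... | inj₂ lt    | inj₂ ge    = contradiction
  (<-≤-trans (subst (λ p → f p < τ) (rootOf-constant p q) lt) ge) (<-irrefl refl)

-- `f` ranges over all functions, so as to include the index of the first bag in a path
-- decomposition, where vertices may share a value.
Crowded : ℕ → Tree → Set
Crowded m t = ∀ (f : Pos t → ℕ) → ∃ λ τ → ∃ λ ps → Unique ps × All (Active f τ) ps × length ps ≡ m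

Crowded-right : ∀ {m l r} → Crowded m r → Crowded m (node l r)
Crowded-right crowded f with crowded (f ∘ right)
... | τ , ps , unique , active , len =
  τ , map right ps , Unique.map⁺ right-injective unique
  , All.map⁺ (All.map (Active-map right right-∼ {f = f}) active) , trans (length-map right ps) len

Crowded-path : ∀ {m s} L → Crowded m s → Crowded m (path L s)
Crowded-path zero    crowded = crowded
Crowded-path (suc L) crowded = Crowded-right (Crowded-path L crowded)

-- A crowded tree embedded in `t`. The `suc` ensures an active vertex, from which `early-vertex` and
-- `late-vertex` are read off.
record Limb (m : ℕ) (t : Tree) : Set where
  field
    shape       : Tree
    ι           : Pos shape → Pos t
    ι-injective : ∀ {p q} → ι p ≡ ι q → p ≡ q
    ι-∼         : ∀ {p q} → p ∼ q → ι p ∼ ι q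
    crowded     : Crowded (suc m) shape
open Limb

-- The path from the limb A to the root avoids the limb B.
Clear : ∀ {m t} → Limb m t → Limb m t → Set
Clear A B = ∀ {q x y} → q ≽ ι A x → q ≢ ι B y

moment : ∀ {m t} → (Pos t → ℕ) → Limb m t → ℕ
moment f X = proj₁ (crowded X (f ∘ ι X))

early-vertex : ∀ {m t} (f : Pos t → ℕ) (X : Limb m t) → ∃ λ x → f (ι X x) ≤ moment f X
early-vertex f X with crowded X (f ∘ ι X)
... | τ , x ∷ _ , _ , (low , _) ∷ _ , _ = x , low

late-vertex : ∀ {m t} (f : Pos t → ℕ) (X : Limb m t) → ∃ λ x → moment f X ≤ f (ι X x)
late-vertex f X with crowded X (f ∘ ι X)
... | τ , _ ∷ _ , _ , (_ , x , _ , high) ∷ _ , _ = x , high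

-- The limb that is crowded second gains an active vertex from the path joining the other two.
gain : ∀ {m t} (f : Pos t → ℕ) (X Y Z : Limb m t) → moment f X ≤ moment f Y → moment f Y ≤ moment f Z →
       Clear X Y → Clear Z Y →
       ∃ λ τ → ∃ λ ps → Unique ps × All (Active f τ) ps × length ps ≡ 2 + m
gain f X Y Z xy yz XY ZY with early-vertex f X | late-vertex f Z
... | x , early | z , late with crowded Y (f ∘ ι Y)
...   | τ , ps , unique , active , len = τ , extend (bridge f τ _ _ (≤-trans early xy) (≤-trans yz late))
  where
    add : ∀ q → (∀ {y} → q ≢ ι Y y) → Active f τ q →
          ∃ λ ps → Unique ps × All (Active f τ) ps × length ps ≡ _
    add q fresh q-active = q ∷ map (ι Y) ps
      , All.map⁺ (All.universal (λ _ → fresh) ps) ∷ Unique.map⁺ (ι-injective Y) unique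
      , q-active ∷ All.map⁺ (All.map (Active-map (ι Y) (ι-∼ Y) {f = f}) active)
      , cong suc (trans (length-map (ι Y) ps) len)

    extend : ActiveAbove f τ (ι X x) ⊎ ActiveAbove f τ (ι Z z) →
             ∃ λ ps → Unique ps × All (Active f τ) ps × length ps ≡ _
    extend (inj₁ (q , q≽ , q-active)) = add q (XY q≽) q-active
    extend (inj₂ (q , q≽ , q-active)) = add q (ZY q≽) q-active

-- `gain` is applied with the limb of middle moment in second place. Any limb may be that one, hence
-- all six conditions.
three-limbs : ∀ {m t} (A B C : Limb m t) →
              Clear A B → Clear B A → Clear A C → Clear C A → Clear B C → Clear C B → Crowded (2 + m) t
three-limbs A B C AB BA AC CA BC CB f
  with ≤-total (moment f A) (moment f B) | ≤-total (moment f B) (moment f C) | ≤-total (moment f A) (moment f C)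
... | inj₁ ab | inj₁ bc | _       = gain f A B C ab bc AB CB
... | inj₁ ab | inj₂ cb | inj₁ ac = gain f A C B ac cb AC BC
... | inj₁ ab | inj₂ cb | inj₂ ca = gain f C A B ca ab CA BA
... | inj₂ ba | inj₁ bc | inj₁ ac = gain f B A C ba ac BA CA
... | inj₂ ba | inj₁ bc | inj₂ ca = gain f B C A bc ca BC AC
... | inj₂ ba | inj₂ cb | _       = gain f C B A cb ba CB AB

deep : ∀ L {s} → Pos s → Pos (path L s)
deep zero    p = p
deep (suc L) p = right (deep L p)

deep-injective : ∀ L {s} {p q : Pos s} → deep L p ≡ deep L q → p ≡ q
deep-injective zero    eq = eq
deep-injective (suc L) eq = deep-injective L (right-injective eq)

deep-∼ : ∀ L {s} {p q : Pos s} → p ∼ q → deep L p ∼ deep L q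
deep-∼ zero    e = e
deep-∼ (suc L) e = right-∼ (deep-∼ L e)

left-clear : ∀ L {a b} {q : Pos (path L (node a b))} {x y} → q ≽ deep L (left x) → q ≢ deep L (right y)
left-clear zero    top       ()
left-clear zero    (left _)  ()
left-clear (suc L) (right d) eq = left-clear L d (right-injective eq)

right-clear : ∀ L {a b} {q : Pos (path L (node a b))} {x y} → q ≽ deep L (right x) → q ≢ deep L (left y)
right-clear zero    top       ()
right-clear zero    (right _) ()
right-clear (suc L) (right d) eq = right-clear L d (right-injective eq)

Crowded-fork : ∀ {m a b c} L → Crowded (suc m) a → Crowded (suc m) b → Crowded (suc m) c →
               Crowded (2 + m) (node (path L (node a b)) c)
Crowded-fork {m} {a} {b} {c} L ca cb cc = three-limbs A B C
  (λ { (left d) eq → left-clear L d (left-injective eq) })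
  (λ { (left d) eq → right-clear L d (left-injective eq) })
  (λ { top () ; (left _) () }) (λ { top () ; (right _) () })
  (λ { top () ; (left _) () }) (λ { top () ; (right _) () })
  where
    t = node (path L (node a b)) c

    A B C : Limb m t
    A = record { ι = left ∘ deep L ∘ left
               ; ι-injective = left-injective ∘ deep-injective L ∘ left-injective
               ; ι-∼ = left-∼ ∘ deep-∼ L ∘ left-∼ ; crowded = ca }
    B = record { ι = left ∘ deep L ∘ right
               ; ι-injective = right-injective ∘ deep-injective L ∘ left-injective
               ; ι-∼ = left-∼ ∘ deep-∼ L ∘ right-∼ ; crowded = cb }
    C = record { ι = right ; ι-injective = right-injective ; ι-∼ = right-∼ ; crowded = cc }

-- Two levels of height supply three disjoint copies of the previous tree, two below the arm and one
-- in the upper copy.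
binaryTree-crowded : ∀ m → Crowded (suc m) (binaryTree (m * 2))
binaryTree-crowded zero f = f top , top ∷ [] , [] ∷ [] , (≤-refl , top , inj₁ refl , ≤-refl) ∷ [] , refl
binaryTree-crowded (suc m) =
  Crowded-fork (armLength (suc h)) (Crowded-path (armLength h) crowded-h) crowded-h (Crowded-right crowded-h)
  where
    h = m * 2
    crowded-h = binaryTree-crowded m

-- Pathwidth and linear clique-width

ActiveAt : ∀ {n} → Graph n → (Fin n → ℕ) → ℕ → Fin n → Set
ActiveAt G f τ v = f v ≤ τ × ∃ λ w → (w ≡ v ⊎ adj G v w ≡ true) × τ ≤ f w

-- A variant of the vertex separation number in which vertices placed at `τ` also count.
Layout : ∀ {n} → ℕ → Graph n → Set
Layout {n} m G = ∃ λ f → ∀ τ (vs : List (Fin n)) → Unique vs → All (ActiveAt G f τ) vs → length vs ≤ m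

Crowded⇒¬Layout : ∀ {m t} → Crowded (suc m) t → ¬ Layout m (treeGraph t)
Crowded⇒¬Layout {m} {t} crowded (f , bound) with crowded (f ∘ index)
... | τ , ps , unique , active , len = <-irrefl refl
  (≤-trans (≤-reflexive (≡-sym (trans (length-map index ps) len)))
    (bound τ (map index ps) (Unique.map⁺ index-injective unique) (All.map⁺ (All.map transfer active))))
  where
    transfer : ∀ {p} → Active (f ∘ index) τ p → ActiveAt (treeGraph t) f τ (index p)
    transfer (low , q , near , high) = low , index q , Sum.map (cong index) adj-index near , high

least : ∀ {n} {P : Fin n → Set} → (∀ i → Dec (P i)) → ∃ P → ∃ λ i → P i × ∀ j → P j → toℕ i ≤ toℕ j
least {suc n} P? (i , Pi) with P? fzero
... | yes P0 = fzero , P0 , λ _ _ → z≤n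
least {suc n} P? (fzero  , Pi) | no ¬P0 = contradiction Pi ¬P0
least {suc n} P? (fsuc i , Pi) | no ¬P0 with least (P? ∘ fsuc) (i , Pi)
... | j , Pj , minimal = fsuc j , Pj , λ { fzero P0 → contradiction P0 ¬P0 ; (fsuc k) Pk → s≤s (minimal k Pk) }

-- Place each vertex at its first bag. A vertex active at `τ` has this bag no later than `τ`, and it
-- lies in a bag no earlier than `τ`: its first one, or one containing the edge to its witness. By
-- interpolation it lies in bag `τ`.
pw⇒Layout : ∀ {n k} (G : Graph n) → pw≤ G k → Layout (suc k) G
pw⇒Layout {n} {k} G (D , width) = f , bound
  where
    first : ∀ v → ∃ λ i → v ∈ bag D i × ∀ j → v ∈ bag D j → toℕ i ≤ toℕ j
    first v = least (λ i → v ∈? bag D i) (cover D v)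

    f : Fin n → ℕ
    f v = toℕ (proj₁ (first v))

    in-bag : ∀ {v} i → ActiveAt G f (toℕ i) v → v ∈ bag D i
    in-bag {v} i (low , w , near , high) with first v
    ... | j , v∈j , _ = between (later near)
      where
        later : w ≡ v ⊎ adj G v w ≡ true → ∃ λ l → toℕ i ≤ toℕ l × v ∈ bag D l
        later (inj₁ refl) = proj₁ (first v) , high , proj₁ (proj₂ (first v))
        later (inj₂ e) with edges D v w e
        ... | l , v∈l , w∈l = l , ≤-trans high (proj₂ (proj₂ (first w)) l w∈l) , v∈l

        between : (∃ λ l → toℕ i ≤ toℕ l × v ∈ bag D l) → v ∈ bag D i
        between (l , i≤l , v∈l) = interpolate D v j i l low i≤l v∈j v∈l

    bound : ∀ τ vs → Unique vs → All (ActiveAt G f τ) vs → length vs ≤ suc k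
    bound τ [] _ _ = z≤n
    bound τ (v ∷ vs) unique active@((_ , w , _ , high) ∷ _) =
      ≤-trans (unique-length unique (All.map (λ a → in-bag i (subst (λ τ → ActiveAt G f τ _) (≡-sym i≡τ) a)) active)) (width i)
      where
        -- The witness of the first active vertex shows that a bag with index `τ` exists.
        τ<len = ≤-<-trans high (toℕ<n (proj₁ (first w)))
        i     = fromℕ< τ<len
        i≡τ   : toℕ i ≡ τ
        i≡τ   = toℕ-fromℕ< τ<len

length-filter-¬ : ∀ {A : Set} {P : A → Set} (P? : ∀ x → Dec (P x)) xs →
                  length xs ≡ length (filter P? xs) + length (filter (¬? ∘ P?) xs)
length-filter-¬ P? [] = refl
length-filter-¬ P? (x ∷ xs) with P? x
... | yes _ = cong suc (length-filter-¬ P? xs)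
... | no  _ = trans (cong suc (length-filter-¬ P? xs)) (≡-sym (+-suc _ _))

length-fibres : ∀ {A : Set} {Q : A → Set} (g : A → ℕ) c →
  (∀ i ys → Unique ys → All Q ys → All (λ y → g y ≡ i) ys → length ys ≤ c) →
  ∀ m xs → Unique xs → All Q xs → All (λ x → g x < m) xs → length xs ≤ m * c
length-fibres g c fibre zero    []      _ _ _        = z≤n
length-fibres g c fibre zero    (_ ∷ _) _ _ (() ∷ _)
length-fibres g c fibre (suc m) xs u q b = ≤-trans (≤-reflexive (length-filter-¬ P? xs))
  (+-mono-≤ (fibre m (filter P? xs) (Unique.filter⁺ P? u) (All.filter⁺ P? q) (All.all-filter P? xs))
            (length-fibres g c fibre m (filter (¬? ∘ P?) xs) (Unique.filter⁺ (¬? ∘ P?) u) (All.filter⁺ (¬? ∘ P?) q)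
              (All.zipWith (λ { (s≤s le , ne) → ≤∧≢⇒< le ne }) (All.filter⁺ (¬? ∘ P?) b , All.all-filter (¬? ∘ P?) xs))))
  where
    P? = λ x → g x ≟ m

-- Runs of linear clique-width expressions

Created : ∀ {n k} → LState n k → Fin n → Set
Created s v = ∃ λ i → label s v ≡ just i

Fresh : ∀ {n k} → LState n k → Fin n → Set
Fresh s v = label s v ≡ nothing

¬Created×Fresh : ∀ {n k} {s : LState n k} {v} → Created s v → ¬ Fresh s v
¬Created×Fresh (i , eq) fr with trans (≡-sym eq) fr
... | ()

hasLabel⇒Created : ∀ {n k} (s : LState n k) i v → hasLabel s i v ≡ true → Created s v
hasLabel⇒Created s i v e with label s v
... | just j = j , refl

hasLabel-cong : ∀ {n k} (s : LState n k) i {u v} → label s u ≡ label s v → hasLabel s i u ≡ hasLabel s i v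
hasLabel-cong s i {u} {v} e with label s u | label s v
hasLabel-cong s i refl | _ | _ = refl

-- Operations of every kind count, so for a vertex created by `os` a value below `τ` means creation
-- within the first `τ` operations.
creation : ∀ {n k} → List (LOp n k) → Fin n → ℕ
creation []                  v = 0
creation (create u i ∷ os)   v with v Fin.≟ u
... | yes _ = 0
... | no  _ = suc (creation os v)
creation (join i j ∷ os)     v = suc (creation os v)
creation (relabel i j ∷ os)  v = suc (creation os v)

creation-self : ∀ {n k} (v : Fin n) {i : Fin k} {os} → creation (create v i ∷ os) v ≡ 0
creation-self v with v Fin.≟ v
... | yes _  = refl
... | no v≢v = contradiction refl v≢v

creation-other : ∀ {n k} {u v : Fin n} {i : Fin k} {os} → v ≢ u → creation (create u i ∷ os) v ≡ suc (creation os v)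
creation-other {u = u} {v} v≢u with v Fin.≟ u
... | yes v≡u = contradiction v≡u v≢u
... | no _    = refl

if-self : ∀ {A : Set} {n} (v : Fin n) {x y : A} → (if ⌊ v Fin.≟ v ⌋ then x else y) ≡ x
if-self v with v Fin.≟ v
... | yes _  = refl
... | no v≢v = contradiction refl v≢v

if-other : ∀ {A : Set} {n} {u v : Fin n} {x y : A} → v ≢ u → (if ⌊ v Fin.≟ u ⌋ then x else y) ≡ y
if-other {u = u} {v} v≢u with v Fin.≟ u
... | yes v≡u = contradiction v≡u v≢u
... | no _    = refl

relabel-fresh : ∀ {n k} (s : LState n k) i j {v} → Fresh s v → (if hasLabel s i v then just j else label s v) ≡ nothing
relabel-fresh s i j fr rewrite fr = refl

relabel-created : ∀ {n k} (s : LState n k) i j {v} → Created s v →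
                  ∃ λ l → (if hasLabel s i v then just j else label s v) ≡ just l
relabel-created s i j {v} created with hasLabel s i v
... | true  = j , refl
... | false = created

data StepCase {n k} (o : LOp n k) (os : List (LOp n k)) (s s′ : LState n k) (v : Fin n) : Set where
  now   : ∀ i → o ≡ create v i → creation (o ∷ os) v ≡ 0 → Fresh s v → Created s′ v → StepCase o os s s′ v
  later : creation (o ∷ os) v ≡ suc (creation os v) → (Fresh s v → Fresh s′ v) →
          (Created s v → Created s′ v) → StepCase o os s s′ v

step-case : ∀ {n k} (o : LOp n k) os s s′ → step o s ≡ just s′ → ∀ v → StepCase o os s s′ v
step-case (create u i) os s s′ e v with label s u in eq
step-case (create u i) os s s′ refl v | nothing with v Fin.≟ u
... | yes refl = now i refl (creation-self v {i} {os}) eq (i , if-self v)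
... | no v≢u   = later (creation-other {i = i} {os} v≢u) (trans (if-other v≢u))
                       (λ (j , e) → j , trans (if-other v≢u) e)
step-case (join i j) os s s′ e v with i Fin.≟ j
step-case (join i j) os s s′ refl v | no _ = later refl id id
step-case (relabel i j) os s s′ refl v = later refl (relabel-fresh s i j) (relabel-created s i j)

-- An invariant of runs, from which a vertex still to be created has no edges yet.
Sound : ∀ {n k} → LState n k → Set
Sound s = ∀ u w → edge s u w ≡ true → Created s w

∨-true : ∀ a b → a ∨ b ≡ true → a ≡ true ⊎ b ≡ true
∨-true true  b e = inj₁ refl
∨-true false b e = inj₂ e

∧-trueʳ : ∀ a b → a ∧ b ≡ true → b ≡ true
∧-trueʳ true b e = e

step-sound : ∀ {n k} (o : LOp n k) s s′ → step o s ≡ just s′ → Sound s → Sound s′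
step-sound (create v i) s s′ e sound u w uw with step-case (create v i) [] s s′ e w
... | now _ _ _ _ created = created
... | later _ _ created with label s v
step-sound (create v i) s s′ refl sound u w uw | later _ _ created | nothing = created (sound u w uw)
step-sound (join i j) s s′ e sound u w uw with i Fin.≟ j
step-sound (join i j) s s′ refl sound u w uw | no _
  with ∨-true (edge s u w) _ uw
... | inj₁ old = sound u w old
... | inj₂ new with ∨-true (hasLabel s i u ∧ hasLabel s j w) _ new
...   | inj₁ ij = hasLabel⇒Created s j w (∧-trueʳ (hasLabel s i u) _ ij)
...   | inj₂ ji = hasLabel⇒Created s i w (∧-trueʳ (hasLabel s j u) _ ji)
step-sound (relabel i j) s s′ refl sound u w uw = relabel-created s i j (sound u w uw)

-- Later operations treat equally labelled vertices alike. `Created s u` rules out a later `create`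
-- that would change the label of only one of them.
Twins : ∀ {n k} → LState n k → Fin n → Fin n → Fin n → Set
Twins s w u v = label s u ≡ label s v × Created s u × edge s u w ≡ edge s v w

step-twins : ∀ {n k} (o : LOp n k) s s′ {u v w} → step o s ≡ just s′ → Twins s w u v → Twins s′ w u v
step-twins (create x i) s s′ {u} {v} e (same , created , adjacent) with label s x in eq
step-twins (create x i) s s′ {u} {v} refl (same , (l , eu) , adjacent) | nothing =
  trans (if-other u≢x) (trans same (≡-sym (if-other v≢x))) , (l , trans (if-other u≢x) eu) , adjacent
  where
    u≢x : u ≢ x
    u≢x refl = ¬Created×Fresh {s = s} (l , eu) eq
    v≢x : v ≢ x
    v≢x refl = ¬Created×Fresh {s = s} (l , trans (≡-sym same) eu) eq
step-twins (join i j) s s′ e twins with i Fin.≟ j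
step-twins (join i j) s s′ {u} {v} {w} refl (same , created , adjacent) | no _ =
  same , created , cong₂ _∨_ adjacent (cong₂ _∨_ (cong (_∧ hasLabel s j w) (hasLabel-cong s i same))
                                                 (cong (_∧ hasLabel s i w) (hasLabel-cong s j same)))
step-twins (relabel i j) s s′ {u} {v} refl (same , created , adjacent) =
  cong₂ (λ b l → if b then just j else l) (hasLabel-cong s i same) same , relabel-created s i j created , adjacent

run-twins : ∀ {n k} (os : List (LOp n k)) s s′ {u v w} → run os s ≡ just s′ → Twins s w u v → Twins s′ w u v
run-twins []       s s′ refl twins = twins
run-twins (o ∷ os) s s′ e twins with step o s in eq
... | just s₁ = run-twins os s₁ s′ e (step-twins o s s₁ eq twins)

-- One operation creates at most one vertex, and every vertex is created in the end.
creation-injective : ∀ {n k} (os : List (LOp n k)) s s′ {u v} → run os s ≡ just s′ → (∀ v → Created s′ v) →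
                     Fresh s u → Fresh s v → creation os u ≡ creation os v → u ≡ v
creation-injective [] s s′ refl all fu fv _ = contradiction fu (¬Created×Fresh {s = s} (all _))
creation-injective (o ∷ os) s s′ {u} {v} e all fu fv eq with step o s in stepped
... | just s₁ with step-case o os s s₁ stepped u | step-case o os s s₁ stepped v
...   | now _ refl _ _ _ | now _ refl _ _ _ = refl
...   | now _ _ cu _ _   | later cv _ _     = contradiction (trans (≡-sym cu) (trans eq cv)) (λ ())
...   | later cu _ _     | now _ _ cv _ _   = contradiction (trans (≡-sym cv) (trans (≡-sym eq) cu)) (λ ())
...   | later cu f _     | later cv f′ _    =
  creation-injective os s₁ s′ e all (f fu) (f′ fv) (suc-injective (trans (≡-sym cu) (trans eq cv)))

-- The situation after `τ` operations, or at the end if there are fewer.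
record Snapshot {n k} (τ : ℕ) (os : List (LOp n k)) (s s′ : LState n k) : Set where
  field
    state   : LState n k
    rest    : List (LOp n k)
    resume  : run rest state ≡ just s′
    sound   : Sound state
    created : ∀ v → Created s v ⊎ creation os v < τ → Created state v
    fresh   : ∀ v → Fresh s v → τ ≤ creation os v → Fresh state v

snapshot : ∀ {n k} τ (os : List (LOp n k)) s s′ → run os s ≡ just s′ → Sound s → (∀ v → Created s′ v) →
           Snapshot τ os s s′
snapshot τ [] s s′ refl sound all = record
  { state = s ; rest = [] ; resume = refl ; sound = sound ; created = λ v _ → all v ; fresh = λ _ fr _ → fr }
snapshot zero os s s′ e sound all = record
  { state = s ; rest = os ; resume = e ; sound = sound
  ; created = λ { v (inj₁ c) → c } ; fresh = λ _ fr _ → fr }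
snapshot (suc τ) (o ∷ os) s s′ e sound all with step o s in stepped
... | just s₁ = record
  { state = state ; rest = rest ; resume = resume ; sound = Snapshot.sound later-on
  ; created = λ v → created v ∘ before v ; fresh = after }
  where
    later-on = snapshot τ os s₁ s′ e (step-sound o s s₁ stepped sound) all
    open Snapshot later-on using (state; rest; resume; created; fresh)

    before : ∀ v → Created s v ⊎ creation (o ∷ os) v < suc τ → Created s₁ v ⊎ creation os v < τ
    before v c with step-case o os s s₁ stepped v | c
    ... | now _ _ _ _ c₁ | _            = inj₁ c₁
    ... | later _ _ keep | inj₁ c₀      = inj₁ (keep c₀)
    ... | later eq _ _   | inj₂ (s≤s b) = inj₂ (subst (_≤ τ) eq b)

    after : ∀ v → Fresh s v → suc τ ≤ creation (o ∷ os) v → Fresh state v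
    after v fr b with step-case o os s s₁ stepped v
    ... | now _ _ eq _ _  = contradiction (subst (suc τ ≤_) eq b) (λ ())
    ... | later eq keep _ = fresh v (keep fr) (s≤s⁻¹ (subst (suc τ ≤_) eq b))

-- When vertex number τ is created, created vertices with the same label have the same
-- neighbours to come, so by the degree bound every label class has at most suc d active vertices.
lcw⇒Layout : ∀ {n k d} (G : Graph n) → MaxDegree≤ (suc d) G → lcw≤ G k → Layout (suc k * suc d) G
lcw⇒Layout {n} {k} {d} G degree≤ (os , s′ , ran , all , realises) = creation os , bound
  where
    bound : ∀ τ vs → Unique vs → All (ActiveAt G (creation os) τ) vs → length vs ≤ suc k * suc d
    bound τ vs unique active =
      length-fibres class (suc d) fibre (suc k) vs unique active (All.universal class< vs)
      where
        open Snapshot (snapshot τ os emptyState s′ ran (λ _ _ ()) all)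

        -- Class `0` collects the vertices still to be created, so there are `suc k` classes.
        class : Fin n → ℕ
        class v = maybe′ (suc ∘ toℕ) 0 (label state v)

        class< : ∀ v → class v < suc k
        class< v with label state v
        ... | just i  = s≤s (toℕ<n i)
        ... | nothing = s≤s z≤n

        class-zero : ∀ v → class v ≡ 0 → Fresh state v
        class-zero v e with label state v
        ... | nothing = refl

        class-suc : ∀ {i} v → class v ≡ suc i → ∃ λ j → label state v ≡ just j × toℕ j ≡ i
        class-suc v e with label state v
        ... | just j = j , refl , suc-injective e

        fibre : ∀ i ys → Unique ys → All (ActiveAt G (creation os) τ) ys → All (λ y → class y ≡ i) ys →
                length ys ≤ suc d
        fibre i [] _ _ _ = z≤n
        -- The degree bound is written `suc d` to leave room for one vertex.
        fibre i (y ∷ []) _ _ _ = s≤s z≤n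
        -- Active vertices not yet created are created exactly at time `τ`, which two different
        -- vertices cannot share.
        fibre zero (y ∷ y′ ∷ _) ((y≢y′ ∷ _) ∷ _) ((low , _) ∷ (low′ , _) ∷ _) (cy ∷ cy′ ∷ _) =
          contradiction (creation-injective os emptyState s′ ran all refl refl
            (trans (at-τ y low cy) (≡-sym (at-τ y′ low′ cy′)))) y≢y′
          where
            at-τ : ∀ y → creation os y ≤ τ → class y ≡ 0 → creation os y ≡ τ
            at-τ y low c with m≤n⇒m<n∨m≡n low
            ... | inj₁ lt = contradiction (class-zero y c) (¬Created×Fresh {s = state} (created y (inj₂ lt)))
            ... | inj₂ eq = eq
        -- The witness `w` of `y` is still to be created, and the whole class ends up among its
        -- neighbours.
        fibre (suc i) (y ∷ ys) unique ((low , w , near , high) ∷ _) classes@(cy ∷ _) =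
          ≤-trans (unique-length unique (All.map (λ {v} c → ∈-tabulate⁺ (trans (Graph.sym G w v) (adjacent v c))) classes)) (degree≤ w)
          where
            fresh-w : Fresh state w
            fresh-w = fresh w refl high

            y∼w : w ≡ y ⊎ adj G y w ≡ true → adj G y w ≡ true
            y∼w (inj₂ e)    = e
            y∼w (inj₁ refl) with class-suc y cy
            ... | j , eq , _ = contradiction fresh-w (¬Created×Fresh {s = state} (j , eq))

            no-edge : ∀ v → edge state v w ≡ false
            no-edge v with edge state v w in eq
            ... | false = refl
            ... | true  = contradiction fresh-w (¬Created×Fresh {s = state} (sound v w eq))

            adjacent : ∀ v → class v ≡ suc i → adj G v w ≡ true
            adjacent v cv with class-suc v cv | class-suc y cy
            ... | j , ev , j≡i | j′ , ey , j′≡i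
              with toℕ-injective (trans j≡i (≡-sym j′≡i))
            ... | refl = trans (≡-sym (realises v w)) (trans twin (trans (realises y w) (y∼w near)))
              where
                twin : edge s′ v w ≡ edge s′ y w
                -- At the snapshot neither vertex has an edge to `w`, and their labels agree.
                twin = proj₂ (proj₂ (run-twins rest state s′ {v} {y} {w} resume
                  (trans ev (≡-sym ey) , (j , ev) , trans (no-edge v) (≡-sym (no-edge y)))))

-- The class and its widths

data BinaryTrees : Class where
  binary : ∀ h → BinaryTrees (treeGraph (binaryTree h))

BinaryTrees-¬Layout : ∀ m → ∃ λ n → Σ (Graph n) λ G → BinaryTrees G × MaxDegree≤ 3 G × ¬ Layout m G
BinaryTrees-¬Layout m = size t , treeGraph t , binary (m * 2) , treeGraph-subcubic t
                      , Crowded⇒¬Layout (binaryTree-crowded m)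
  where
    t = binaryTree (m * 2)

BinaryTrees-unbounded : (width≤ : ∀ {n} → Graph n → ℕ → Set) (bound : ℕ → ℕ) →
  (∀ {n k} (G : Graph n) → MaxDegree≤ 3 G → width≤ G k → Layout (bound k) G) →
  ∀ k → ∃ λ n → Σ (Graph n) λ G → BinaryTrees G × ¬ width≤ G k
BinaryTrees-unbounded width≤ bound layout k = narrow (BinaryTrees-¬Layout (bound k))
  where
    narrow : (∃ λ n → Σ (Graph n) λ G → BinaryTrees G × MaxDegree≤ 3 G × ¬ Layout (bound k) G) →
             ∃ λ n → Σ (Graph n) λ G → BinaryTrees G × ¬ width≤ G k
    narrow (n , G , bt , degree≤3 , ¬layout) = n , G , bt , ¬layout ∘ layout G degree≤3

BinaryTrees-unbounded-pw : UnboundedPathwidth BinaryTrees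
BinaryTrees-unbounded-pw = BinaryTrees-unbounded pw≤ suc λ G _ → pw⇒Layout G

BinaryTrees-unbounded-lcw : UnboundedLinearCliqueWidth BinaryTrees
BinaryTrees-unbounded-lcw = BinaryTrees-unbounded lcw≤ (λ k → suc k * 3) lcw⇒Layout

BinaryTrees-bounded-bcw : ∀ r → BoundedBlindCopWidth r BinaryTrees
BinaryTrees-bounded-bcw r = 3 + size (binaryTree r) , λ { _ (binary h) → binaryTree-bcw r h }

BinaryTrees-subcubic : ∀ {n} (G : Graph n) → BinaryTrees G → IsSubcubicTree G
BinaryTrees-subcubic _ (binary h) = treeGraph-isSubcubicTree (leftArm h) (rightArm h)

BinaryTrees-bounded-bfw : BoundedBlindFlipWidth BinaryTrees
BinaryTrees-bounded-bfw =
    -- Radius `0` is included, since the cop bound holds for every `r`; the factor `3` is the degree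
    -- bound.
    (λ r → let k = proj₁ (BinaryTrees-bounded-bcw r) in suc (k + k * 3))
  , λ r G bt → bcw⇒bfw G (proj₂ (BinaryTrees-subcubic G bt)) (proj₂ (BinaryTrees-bounded-bcw r) G bt)

theorem5p1 : Σ Class λ 𝒞 →
    (∀ {n} (G : Graph n) → 𝒞 G → IsSubcubicTree G) ×
    (∀ r → 1 ≤ r → BoundedBlindCopWidth r 𝒞) ×
    UnboundedPathwidth 𝒞 ×
    BoundedBlindFlipWidth 𝒞 ×
    UnboundedLinearCliqueWidth 𝒞
theorem5p1 =
    BinaryTrees
  , BinaryTrees-subcubic
  , (λ r _ → BinaryTrees-bounded-bcw r)
  , BinaryTrees-unbounded-pw
  , BinaryTrees-bounded-bfw
  , BinaryTrees-unbounded-lcw
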